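{- There exist a graph $M$, a class $\mathcal{H}$ of $M$-minor-free graphs, and a component-closed graph class $\mathcal{G}$ containing $K_2$ such that $\mathcal{H}$ is not $(c^{\mathcal{G}}_{\mathrm u},c^{\mathcal{G}}_{\mathrm l})$-bounded.
   Context: All graphs are finite and simple. A class is component-closed if every connected component of every member is a member; a graph is $M$-minor-free if it does not contain $M$ as a minor. For graphs $G,H$, a homomorphism $\varphi\colon G\to H$ is a map $V(G)\to V(H)$ with $\varphi(u)\varphi(v)\in E(H)$ whenever $uv\in E(G)$. $\dot\cup$ denotes vertex-disjoint union. For a graph class $\mathcal{G}$ and a graph $H$, a $\mathcal{G}$-cover of $H$ is an edge-surjective homomorphism $\varphi\colon G_1\dot\cup\cdots\dot\cup G_t\to H$ with all $G_i\in\mathcal{G}$; it is called $t$-global, injective if each $\varphi|_{G_i}$ is injective, and $s$-local if $|\varphi^{ -1}(v)|\le s$ for all $v\in V(H)$. $\overline{\mathcal{G}}$ is the class of all vertex-disjoint unions of graphs in $\mathcal{G}$. $c^{\mathcal{G}}_{\mathrm u}(H)$ is the least $t$ such that $H$ has a $t$-global injective $\overline{\mathcal{G}}$-cover; $c^{\mathcal{G}}_{\mathrm l}(H)$ is the least $s$ such that $H$ has an $s$-local injective $\mathcal{G}$-cover. $\mathcal{H}$ is $(c^{\mathcal{G}}_{\mathrm u},c^{\mathcal{G}}_{\mathrm l})$-bounded if there is $f\colon\mathbb{N}\to\mathbb{R}_{\ge0}$ with $c^{\mathcal{G}}_{\mathrm l}(H)\le c^{\mathcal{G}}_{\mathrm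 u}(H)\le f(c^{\mathcal{G}}_{\mathrm l}(H))$ for all $H\in\mathcal{H}$. -}

module Defs where

open import Data.Nat using (ℕ; zero; suc; _+_; _≤_)
open import Data.Bool using (Bool; true; false; not; if_then_else_)
open import Data.Fin using (Fin; zero; suc; splitAt)
open import Data.Fin.Properties using (_≟_)
open import Data.Sum using (_⊎_; inj₁; inj₂)
open import Data.Product using (Σ; ∃; ∃₂; _×_; _,_)
open import Data.List using (List; []; _∷_; foldr)
open import Data.List.Relation.Unary.All using (All)
open import Data.Maybe using (Maybe; just)
open import Data.Unit using (⊤)
open import Data.Empty using (⊥)
open import Relation.Nullary using (¬_)
open import Relation.Nullary.Decidable using (⌊_⌋)
open import Relation.Binary.PropositionalEquality using (_≡_; refl)
open import Function.Definitions using (Injective)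

record Graph : Set where
  field
    size   : ℕ
    adj    : Fin size → Fin size → Bool
    sym    : ∀ i j → adj i j ≡ adj j i
    irrefl : ∀ i → adj i i ≡ false

open Graph public

V : Graph → Set
V G = Fin (size G)

Adj : (G : Graph) → V G → V G → Set
Adj G u v = adj G u v ≡ true

record _≅_ (G H : Graph) : Set where
  field
    to      : V G → V H
    from    : V H → V G
    from-to : ∀ x → from (to x) ≡ x
    to-from : ∀ y → to (from y) ≡ y
    pres    : ∀ u v → adj G u v ≡ adj H (to u) (to v)

GraphClass : Set₁
GraphClass = Graph → Set

IsoClosed : GraphClass → Set
IsoClosed 𝒢 = ∀ G H → G ≅ H → 𝒢 G → 𝒢 H

K2 : Graph
K2 = record
  { size = 2 ; adj = λ i j → not ⌊ i ≟ j ⌋ ; sym = s ; irrefl = r }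
  where
  s : ∀ (i j : Fin 2) → not ⌊ i ≟ j ⌋ ≡ not ⌊ j ≟ i ⌋
  s zero zero = refl
  s zero (suc zero) = refl
  s (suc zero) zero = refl
  s (suc zero) (suc zero) = refl
  r : ∀ (i : Fin 2) → not ⌊ i ≟ i ⌋ ≡ false
  r zero = refl
  r (suc zero) = refl

private
  adjU : (G H : Graph) → V G ⊎ V H → V G ⊎ V H → Bool
  adjU G H (inj₁ a) (inj₁ b) = adj G a b
  adjU G H (inj₁ a) (inj₂ b) = false
  adjU G H (inj₂ a) (inj₁ b) = false
  adjU G H (inj₂ a) (inj₂ b) = adj H a b

  adjU-sym : ∀ G H x y → adjU G H x y ≡ adjU G H y x
  adjU-sym G H (inj₁ a) (inj₁ b) = sym G a b
  adjU-sym G H (inj₁ a) (inj₂ b) = refl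
  adjU-sym G H (inj₂ a) (inj₁ b) = refl
  adjU-sym G H (inj₂ a) (inj₂ b) = sym H a b

  adjU-irr : ∀ G H x → adjU G H x x ≡ false
  adjU-irr G H (inj₁ a) = irrefl G a
  adjU-irr G H (inj₂ a) = irrefl H a

_⊕_ : Graph → Graph → Graph
G ⊕ H = record
  { size = size G + size H
  ; adj = λ x y → adjU G H (splitAt (size G) x) (splitAt (size G) y)
  ; sym = λ x y → adjU-sym G H (splitAt (size G) x) (splitAt (size G) y)
  ; irrefl = λ x → adjU-irr G H (splitAt (size G) x)
  }

emptyGraph : Graph
emptyGraph = record { size = 0 ; adj = λ () ; sym = λ () ; irrefl = λ () }

⨁ : List Graph → Graph
⨁ = foldr _⊕_ emptyGraph

Overline : GraphClass → GraphClass
Overline 𝒢 G = Σ (List Graph) λ Gs → All 𝒢 Gs × (⨁ Gs ≅ G)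

data Conn (G : Graph) (P : V G → Set) : V G → V G → Set where
  here : ∀ {u} → P u → Conn G P u u
  step : ∀ {u w v} → P u → Adj G u w → Conn G P w v → Conn G P u v

record IsComponent (C G : Graph) : Set where
  field
    emb       : V C → V G
    emb-inj   : Injective _≡_ _≡_ emb
    induced   : ∀ u v → adj C u v ≡ adj G (emb u) (emb v)
    nonempty  : V C
    connected : ∀ u v → Conn C (λ _ → ⊤) u v
    closed    : ∀ u x → Adj G (emb u) x → ∃ λ v → emb v ≡ x

ComponentClosed : GraphClass → Set
ComponentClosed 𝒢 = ∀ G C → 𝒢 G → IsComponent C G → 𝒢 C

record Minor (M G : Graph) : Set where
  field
    branch    : V G → Maybe (V M)
    nonempty  : ∀ i → ∃ λ u → branch u ≡ just i
    connected : ∀ i u v → branch u ≡ just i → branch v ≡ just i →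
                Conn G (λ w → branch w ≡ just i) u v
    edges     : ∀ i j → Adj M i j →
                ∃₂ λ u v → Adj G u v × branch u ≡ just i × branch v ≡ just j

MinorFree : Graph → Graph → Set
MinorFree M G = ¬ Minor M G

IsHom : (G H : Graph) → (V G → V H) → Set
IsHom G H f = ∀ u v → Adj G u v → Adj H (f u) (f v)

-- an injective 𝒢-cover of H: a homomorphism from G_1 ⊍ ... ⊍ G_t
-- (given componentwise), edge-surjective, injective on each G_i
record InjCover (𝒢 : GraphClass) (H : Graph) : Set where
  field
    t        : ℕ
    parts    : Fin t → Graph
    inClass  : ∀ i → 𝒢 (parts i)
    maps     : (i : Fin t) → V (parts i) → V H
    hom      : ∀ i → IsHom (parts i) H (maps i)
    edgeSurj : ∀ x y → Adj H x y →
               ∃ λ i → ∃₂ λ u v →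
                 Adj (parts i) u v × maps i u ≡ x × maps i v ≡ y
    inj      : ∀ i → Injective _≡_ _≡_ (maps i)

open InjCover public

countPre : ∀ {n m} → (Fin n → Fin m) → Fin m → ℕ
countPre {zero}  f x = 0
countPre {suc n} f x =
  (if ⌊ f zero ≟ x ⌋ then 1 else 0) + countPre (λ i → f (suc i)) x

sumFin : (t : ℕ) → (Fin t → ℕ) → ℕ
sumFin zero    g = 0
sumFin (suc t) g = g zero + sumFin t (λ i → g (suc i))

preimages : ∀ {𝒢 H} → InjCover 𝒢 H → V H → ℕ
preimages c x = sumFin (t c) (λ i → countPre (maps c i) x)

GlobalCover : GraphClass → Graph → ℕ → Set
GlobalCover 𝒢 H k = Σ (InjCover (Overline 𝒢) H) λ c → t c ≡ k

LocalCover : GraphClass → Graph → ℕ → Set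
LocalCover 𝒢 H s = Σ (InjCover 𝒢 H) λ c → ∀ x → preimages c x ≤ s

IsCu : GraphClass → Graph → ℕ → Set
IsCu 𝒢 H u = GlobalCover 𝒢 H u × (∀ k → GlobalCover 𝒢 H k → u ≤ k)

IsCl : GraphClass → Graph → ℕ → Set
IsCl 𝒢 H l = LocalCover 𝒢 H l × (∀ s → LocalCover 𝒢 H s → l ≤ s)

Bounded : GraphClass → GraphClass → Set
Bounded ℋ 𝒢 = ∃ λ (f : ℕ → ℕ) → ∀ H → ℋ H → ∀ u l →
  IsCu 𝒢 H u → IsCl 𝒢 H l → l ≤ u × u ≤ f l

{-# OPTIONS --safe #-}
module Submission where

open import Defs
open import Algebra.Properties.CommutativeSemigroup using (interchange)
open import Data.Bool using (Bool; true; false; not; _xor_; _∨_; _∧_; T)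
open import Data.Bool.Properties using (not-distribˡ-xor; not-involutive; xor-comm; xor-identityʳ; xor-same; ∧-zeroʳ; ∨-comm)
import Data.Bool.Properties as Bool
open import Data.Bool.Solver using (module xor-∧-Solver)
open import Data.Empty using (⊥; ⊥-elim)
open import Data.Fin using (Fin; zero; suc; toℕ; fromℕ<; combine; remQuot; splitAt; _↑ˡ_; _↑ʳ_)
open import Data.Fin.Patterns using (0F; 1F; 2F; 3F; 4F)
open import Data.Fin.Properties using (any?; combine-injective; combine-monoˡ-<; combine-remQuot; fromℕ<-injective; injective⇒≤; pigeonhole; remQuot-combine; splitAt-↑ˡ; splitAt-↑ʳ; splitAt⁻¹-↑ˡ; splitAt⁻¹-↑ʳ; toℕ-combine; toℕ-fromℕ<; toℕ-injective; toℕ<n; ↑ˡ-injective; ↑ʳ-injective)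
import Data.Fin.Properties as Fin
open import Data.List using (List; []; _∷_; length; lookup)
open import Data.List.Membership.Propositional.Properties using (∈-lookup)
open import Data.List.Relation.Unary.All using (All; []; _∷_)
import Data.List.Relation.Unary.All as All
open import Data.Maybe using (just)
open import Data.Maybe.Properties using (just-injective)
open import Data.Nat using (ℕ; zero; suc; _+_; _*_; _∸_; _⊓_; _≤_; _<_; _<ᵇ_; _≡ᵇ_; z≤n; s≤s; _≤?_; _<?_)
open import Data.Nat.Induction using (<-rec)
open import Data.Nat.Properties
open import Data.Product using (Σ; ∃; ∃₂; _×_; _,_; proj₁; proj₂)
open import Data.Sum using (_⊎_; inj₁; inj₂)
open import Data.Unit using (⊤; tt)
open import Function using (_∘_; id; case_of_)
open import Function.Definitions using (Injective)
open import Relation.Binary using (Tri; tri<; tri≈; tri>)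
open import Relation.Binary.PropositionalEquality using (_≡_; _≢_; refl; trans; cong; cong₂; subst; subst₂; ≢-sym; module ≡-Reasoning) renaming (sym to ≡-sym)
open import Relation.Nullary using (¬_; Dec; yes; no; does)
open import Relation.Nullary.Decidable using (⌊_⌋; dec-true; _×-dec_; _⊎-dec_)

-- The N-th graph is a grid with N + 1 rows whose columns end above the grid in
-- hubs, vertices with very many leaves.  The hubs lie in three consecutive arcs
-- of the outer face, N + 1 hubs in each, and the i-th piece consists of row i and
-- of the i-th hub column of each arc.  Besides K₂ only the pieces are allowed.
-- Every vertex lies in at most two pieces, so the local number is at most 2.
-- In a global cover with at most N parts, the many leaves of a hub of the
-- middle arc force a piece to be centred at it; degrees and the bipartition
-- then force this piece to have a hub in each of the three arcs.  Two connected
-- subgraphs of a plane graph that both meet three consecutive arcs of the outer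
-- face intersect, so each part contains at most one of the N + 1 centred pieces.
--
-- Planarity is used through parity only: order the vertices from left to right
-- and record above which vertices an edge passes.  For disjoint edges ab and cd
-- these data determine whether the endpoints interlace; the identity is
-- additive, hence holds for disjoint walks, and summed over K₅ it reads 1 = 0.

-- Walks, drawings and the parity obstruction to a K₅ minor.

Conn-map : ∀ {G P Q u v} → (∀ w → P w → Q w) → Conn G P u v → Conn G Q u v
Conn-map f (here p)     = here (f _ p)
Conn-map f (step p e c) = step (f _ p) e (Conn-map f c)

Conn-trans : ∀ {G P u v w} → Conn G P u v → Conn G P v w → Conn G P u w
Conn-trans (here _)     d = d
Conn-trans (step p e c) d = step p e (Conn-trans c d)

Conn-head : ∀ {G P u v} → Conn G P u v → P u
Conn-head (here p)     = p
Conn-head (step p _ _) = p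

Conn-sym : ∀ {G P u v} → Conn G P u v → Conn G P v u
Conn-sym {G} {P} (here p) = here p
Conn-sym {G} {P} (step {u} {w} p e c) =
  Conn-trans (Conn-sym c) (step (Conn-head c) (trans (sym G w u) e) (here p))

-- before is the left-to-right order of the vertices, and above a b v the parity
-- of the number of times the edge ab passes above v.
record Drawing (G : Graph) : Set where
  field
    before : V G → V G → Bool
    above  : V G → V G → V G → Bool
    before-asym : ∀ {a b} → a ≢ b → before b a ≡ not (before a b)

  -- For distinct points on a line, `before a c xor before b c` says that `c` lies between `a` and
  -- `b`; the formula compares this for `c` and for `d`.
  interlace : V G → V G → V G → V G → Bool
  interlace a b c d = (before a c xor before b c) xor (before a d xor before b d)

  field
    noncrossing : ∀ {a b c d} → Adj G a b → Adj G c d →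
      a ≢ c → a ≢ d → b ≢ c → b ≢ d →
      (above a b c xor above a b d) xor (above c d a xor above c d b) ≡ interlace a b c d

module Crossing {G : Graph} (𝒟 : Drawing G) where
  open Drawing 𝒟

  aboveWalk : ∀ {P a b} → Conn G P a b → V G → Bool
  aboveWalk (here _)             v = false
  aboveWalk (step {u} {w} _ _ c) v = above u w v xor aboveWalk c v

  -- Both sides are additive under concatenation: the terms at the intermediate vertex `w` occur
  -- twice and cancel, so `noncrossing` can be summed along the walk. Since `c` and `d` lie outside
  -- `P`, every step is disjoint from the edge.
  walk-edge : ∀ {P a b c d} (p : Conn G P a b) → Adj G c d → ¬ P c → ¬ P d →
    (aboveWalk p c xor aboveWalk p d) xor (above c d a xor above c d b) ≡ interlace a b c d
  walk-edge {a = a} {c = c} {d} (here _) e ¬c ¬d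
    rewrite xor-same (above c d a) | xor-same (before a c) | xor-same (before a d) = refl
  walk-edge {P} {b = b} {c} {d} (step {u} {w} pu f p) e ¬c ¬d = begin
      ((A xor W) xor (A′ xor W′)) xor (x xor z)
        ≡⟨ solve 7 (λ A W A′ W′ x y z → (((A :+ W) :+ (A′ :+ W′)) :+ (x :+ z))
              := (((A :+ A′) :+ (x :+ y)) :+ ((W :+ W′) :+ (y :+ z)))) refl A W A′ W′ x y z ⟩
      ((A xor A′) xor (x xor y)) xor ((W xor W′) xor (y xor z))
        ≡⟨ cong₂ _xor_ (noncrossing f e (≢c pu) (≢d pu) (≢c pw) (≢d pw)) (walk-edge p e ¬c ¬d) ⟩
      interlace u w c d xor interlace w b c d
        ≡⟨ solve 6 (λ m n o m′ n′ o′ →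
              (((m :+ n) :+ (m′ :+ n′)) :+ ((n :+ o) :+ (n′ :+ o′)))
              := ((m :+ o) :+ (m′ :+ o′))) refl
              (before u c) (before w c) (before b c) (before u d) (before w d) (before b d) ⟩
      interlace u b c d ∎
    where
    open ≡-Reasoning
    open xor-∧-Solver
    A = above u w c
    A′ = above u w d
    W = aboveWalk p c
    W′ = aboveWalk p d
    x = above c d u
    y = above c d w
    z = above c d b
    pw = Conn-head p
    ≢c : ∀ {v} → P v → v ≢ c
    ≢c pv refl = ¬c pv
    ≢d : ∀ {v} → P v → v ≢ d
    ≢d pv refl = ¬d pv

  -- The same cancellation along the second walk, each of whose edges contributes an instance of
  -- `walk-edge`.
  walk-walk : ∀ {P Q a b c d} (p : Conn G P a b) (q : Conn G Q c d) → (∀ v → P v → ¬ Q v) →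
    (aboveWalk p c xor aboveWalk p d) xor (aboveWalk q a xor aboveWalk q b) ≡ interlace a b c d
  walk-walk {a = a} {b} {c} p (here _) disj
    rewrite xor-same (aboveWalk p c) | xor-same (before a c xor before b c) = refl
  walk-walk {a = a} {b} {d = d} p (step {u} {w} qu f q) disj = begin
      (x xor z) xor ((A xor W) xor (A′ xor W′))
        ≡⟨ solve 7 (λ A W A′ W′ x y z → ((x :+ z) :+ ((A :+ W) :+ (A′ :+ W′)))
              := (((x :+ y) :+ (A :+ A′)) :+ ((y :+ z) :+ (W :+ W′)))) refl A W A′ W′ x y z ⟩
      ((x xor y) xor (A xor A′)) xor ((y xor z) xor (W xor W′))
        ≡⟨ cong₂ _xor_ (walk-edge p f (λ pu → disj _ pu qu) (λ pw → disj _ pw (Conn-head q)))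
                       (walk-walk p q disj) ⟩
      interlace a b u w xor interlace a b w d
        ≡⟨ solve 3 (λ m n o → ((m :+ n) :+ (n :+ o)) := (m :+ o)) refl
              (before a u xor before b u) (before a w xor before b w) (before a d xor before b d) ⟩
      interlace a b u d ∎
    where
    open ≡-Reasoning
    open xor-∧-Solver
    A = above u w a
    A′ = above u w b
    W = aboveWalk q a
    W′ = aboveWalk q b
    x = aboveWalk p u
    y = aboveWalk p w
    z = aboveWalk p d

K5 : Graph
K5 = record
  { size = 5 ; adj = λ i j → not ⌊ i Fin.≟ j ⌋ ; sym = s ; irrefl = r }
  where
  s : ∀ (i j : Fin 5) → not ⌊ i Fin.≟ j ⌋ ≡ not ⌊ j Fin.≟ i ⌋
  s i j with i Fin.≟ j | j Fin.≟ i
  ... | yes _ | yes _ = refl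
  ... | yes p | no ¬p = ⊥-elim (¬p (≡-sym p))
  ... | no ¬p | yes p = ⊥-elim (¬p (≡-sym p))
  ... | no _  | no _  = refl
  r : ∀ (i : Fin 5) → not ⌊ i Fin.≟ i ⌋ ≡ false
  r i with i Fin.≟ i
  ... | yes _ = refl
  ... | no ¬p = ⊥-elim (¬p refl)

Adj⇒≢ : ∀ G {u v} → Adj G u v → u ≢ v
Adj⇒≢ G {u} e refl with trans (≡-sym e) (irrefl G u)
... | ()

module _ {G : Graph} (𝒟 : Drawing G) (m : Minor K5 G) where
  open Drawing 𝒟
  open Crossing 𝒟
  open Minor m

  private
    rep : Fin 5 → V G
    rep i = proj₁ (nonempty i)

    Either : Fin 5 → Fin 5 → V G → Set
    Either i j v = branch v ≡ just i ⊎ branch v ≡ just j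

    -- Staying in the branch sets of `i` and `j` makes the walks for disjoint index pairs
    -- vertex-disjoint, as `opposite` requires.
    path : ∀ i j → Adj K5 i j → Conn G (Either i j) (rep i) (rep j)
    path i j e with edges i j e
    ... | u , v , uv , ui , vj =
      Conn-trans (Conn-map (λ _ → inj₁) (connected i _ u (proj₂ (nonempty i)) ui))
        (step (inj₁ ui) uv (Conn-map (λ _ → inj₂) (connected j v _ vj (proj₂ (nonempty j)))))

    over : ∀ i j → Adj K5 i j → Fin 5 → Bool
    over i j e k = aboveWalk (path i j e) (rep k)

    branches-disjoint : ∀ {i j} → i ≢ j → ∀ {v} → branch v ≡ just i → branch v ≡ just j → ⊥
    branches-disjoint i≢j p q = i≢j (just-injective (trans (≡-sym p) q))

    rep-≢ : ∀ {i j} → i ≢ j → rep i ≢ rep j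
    rep-≢ {i} {j} i≢j eq = branches-disjoint i≢j (proj₂ (nonempty i))
      (trans (cong branch eq) (proj₂ (nonempty j)))

    -- The four triangles of a tetrahedron contain the same twelve `over` terms as its three pairs
    -- of opposite edges; `tetrahedron` is this double count.
    triangle : ∀ i j k → Adj K5 i j → Adj K5 i k → Adj K5 j k → Bool
    triangle i j k ij ik jk = over i j ij k xor (over i k ik j xor over j k jk i)

    opposite : ∀ i j k l (ij : Adj K5 i j) (kl : Adj K5 k l) →
      i ≢ k → i ≢ l → j ≢ k → j ≢ l →
      (over i j ij k xor over i j ij l) xor (over k l kl i xor over k l kl j)
        ≡ interlace (rep i) (rep j) (rep k) (rep l)
    opposite i j k l ij kl i≢k i≢l j≢k j≢l = walk-walk (path i j ij) (path k l kl) λ where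
      v (inj₁ p) (inj₁ q) → branches-disjoint i≢k p q
      v (inj₁ p) (inj₂ q) → branches-disjoint i≢l p q
      v (inj₂ p) (inj₁ q) → branches-disjoint j≢k p q
      v (inj₂ p) (inj₂ q) → branches-disjoint j≢l p q

    -- Among four points on a line exactly one of the three pairings interlaces.
    tetrahedron : ∀ i j k l (ij : Adj K5 i j) (ik : Adj K5 i k) (il : Adj K5 i l)
      (jk : Adj K5 j k) (jl : Adj K5 j l) (kl : Adj K5 k l) →
      (triangle i j k ij ik jk xor triangle i j l ij il jl) xor
      (triangle i k l ik il kl xor triangle j k l jk jl kl) ≡ true
    tetrahedron i j k l ij ik il jk jl kl = begin
        ((a xor (c xor e)) xor (b xor (g xor h))) xor ((d xor (g′ xor p)) xor (f xor (h′ xor q)))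
          ≡⟨ solve 12 (λ a b c d e f g g′ h h′ p q →
               (((a :+ (c :+ e)) :+ (b :+ (g :+ h))) :+ ((d :+ (g′ :+ p)) :+ (f :+ (h′ :+ q))))
               := (((a :+ b) :+ (p :+ q)) :+ (((c :+ d) :+ (h :+ h′)) :+ ((g :+ g′) :+ (e :+ f)))))
               refl a b c d e f g g′ h h′ p q ⟩
        ((a xor b) xor (p xor q)) xor
        (((c xor d) xor (h xor h′)) xor ((g xor g′) xor (e xor f)))
          ≡⟨ cong₂ _xor_ (opposite i j k l ij kl (ne ik) (ne il) (ne jk) (ne jl))
               (cong₂ _xor_
                 (opposite i k j l ik jl (ne ij) (ne il) (ne′ jk) (ne kl))
                 (opposite i l j k il jk (ne ij) (ne ik) (ne′ jl) (ne′ kl))) ⟩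
        interlace I J K L xor (interlace I K J L xor interlace I L J K)
          ≡⟨ cong₂ (λ s t → interlace I J K L xor
                 (((before I J xor s) xor (before I L xor before K L)) xor t))
               (before-asym (rep-≢ (ne jk)))
               (cong₂ (λ s t → (before I J xor s) xor (before I K xor t))
                  (before-asym (rep-≢ (ne jl))) (before-asym (rep-≢ (ne kl)))) ⟩
        _ ≡⟨ solve 6 (λ ij ik il jk jl kl →
               ((ik :+ jk) :+ (il :+ jl)) :+
               (((ij :+ (con true :+ jk)) :+ (il :+ kl)) :+
                ((ij :+ (con true :+ jl)) :+ (ik :+ (con true :+ kl)))) := con true) refl
               (before I J) (before I K) (before I L) (before J K) (before J L) (before K L) ⟩
        true ∎
      where
      open ≡-Reasoning
      open xor-∧-Solver
      ne : ∀ {x y} → Adj K5 x y → x ≢ y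
      ne = Adj⇒≢ K5
      ne′ : ∀ {x y} → Adj K5 x y → y ≢ x
      ne′ e p = ne e (≡-sym p)
      I = rep i
      J = rep j
      K = rep k
      L = rep l
      a = over i j ij k
      b = over i j ij l
      c = over i k ik j
      d = over i k ik l
      e = over j k jk i
      f = over j k jk l
      g = over i l il j
      g′ = over i l il k
      h = over j l jl i
      h′ = over j l jl k
      p = over k l kl i
      q = over k l kl j

  -- Every triangle of K5 lies on two of its five tetrahedra.
  drawing⇒no-K5-minor : ⊥
  drawing⇒no-K5-minor = contra (trans (≡-sym all-true) cancel)
    where
    open xor-∧-Solver
    contra : true ≡ false → ⊥
    contra ()
    t012 = triangle 0F 1F 2F refl refl refl
    t013 = triangle 0F 1F 3F refl refl refl
    t014 = triangle 0F 1F 4F refl refl refl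
    t023 = triangle 0F 2F 3F refl refl refl
    t024 = triangle 0F 2F 4F refl refl refl
    t034 = triangle 0F 3F 4F refl refl refl
    t123 = triangle 1F 2F 3F refl refl refl
    t124 = triangle 1F 2F 4F refl refl refl
    t134 = triangle 1F 3F 4F refl refl refl
    t234 = triangle 2F 3F 4F refl refl refl
    total = ((t012 xor t013) xor (t023 xor t123)) xor
            (((t012 xor t014) xor (t024 xor t124)) xor
            (((t013 xor t014) xor (t034 xor t134)) xor
            (((t023 xor t024) xor (t034 xor t234)) xor
             ((t123 xor t124) xor (t134 xor t234)))))
    all-true : total ≡ true
    all-true = cong₂ _xor_ (tetrahedron 0F 1F 2F 3F refl refl refl refl refl refl)
      (cong₂ _xor_ (tetrahedron 0F 1F 2F 4F refl refl refl refl refl refl)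
      (cong₂ _xor_ (tetrahedron 0F 1F 3F 4F refl refl refl refl refl refl)
      (cong₂ _xor_ (tetrahedron 0F 2F 3F 4F refl refl refl refl refl refl)
                   (tetrahedron 1F 2F 3F 4F refl refl refl refl refl refl))))
    cancel : total ≡ false
    cancel = solve 10 (λ a b c d e f g h i j →
      ((a :+ b) :+ (d :+ g)) :+ (((a :+ c) :+ (e :+ h)) :+ (((b :+ c) :+ (f :+ i)) :+
      (((d :+ e) :+ (f :+ j)) :+ ((g :+ h) :+ (i :+ j))))) := con false) refl
      t012 t013 t014 t023 t024 t034 t123 t124 t134 t234

-- Embeddings, components and degree bounds.

record _↪_ (G H : Graph) : Set where
  field
    fun   : V G → V H
    fun-hom : IsHom G H fun
    fun-inj : Injective _≡_ _≡_ fun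

open _↪_

_∘↪_ : ∀ {G H K} → H ↪ K → G ↪ H → G ↪ K
g ∘↪ f = record
  { fun     = fun g ∘ fun f
  ; fun-hom = λ u v e → fun-hom g _ _ (fun-hom f u v e)
  ; fun-inj = λ eq → fun-inj f (fun-inj g eq)
  }

≅-refl : ∀ {G} → G ≅ G
≅-refl = record { to = id ; from = id ; from-to = λ _ → refl ; to-from = λ _ → refl ; pres = λ _ _ → refl }

≅-sym : ∀ {G H} → G ≅ H → H ≅ G
≅-sym {H = H} i = record { to = from ; from = to ; from-to = to-from ; to-from = from-to
  ; pres = λ u v → ≡-sym (trans (pres (from u) (from v)) (cong₂ (adj H) (to-from u) (to-from v))) }
  where open _≅_ i

≅-trans : ∀ {G H K} → G ≅ H → H ≅ K → G ≅ K
≅-trans i j = record { to = J.to ∘ I.to ; from = I.from ∘ J.from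
  ; from-to = λ x → trans (cong I.from (J.from-to _)) (I.from-to x)
  ; to-from = λ y → trans (cong J.to (I.to-from _)) (J.to-from y)
  ; pres = λ u v → trans (I.pres u v) (J.pres _ _) }
  where
  module I = _≅_ i
  module J = _≅_ j

≅⇒↪ : ∀ {G H} → G ≅ H → G ↪ H
≅⇒↪ i = record { fun = to
  ; fun-hom = λ u v e → trans (≡-sym (pres u v)) e
  ; fun-inj = λ {x} {y} eq → trans (≡-sym (from-to x)) (trans (cong from eq) (from-to y)) }
  where open _≅_ i

Conn-image : ∀ {G H P Q} (f : V G → V H) → IsHom G H f → (∀ w → P w → Q (f w)) →
  ∀ {u v} → Conn G P u v → Conn H Q (f u) (f v)
Conn-image f h pq (here p)     = here (pq _ p)
Conn-image f h pq (step p e c) = step (pq _ p) (h _ _ e) (Conn-image f h pq c)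

Connected : Graph → Set
Connected G = ∀ u v → Conn G (λ _ → ⊤) u v

≅-connected : ∀ {G H} → G ≅ H → Connected G → Connected H
≅-connected {H = H} i c u v =
  subst₂′ (to-from u) (to-from v) (Conn-image to (fun-hom (≅⇒↪ i)) (λ _ _ → tt) (c (from u) (from v)))
  where
  open _≅_ i
  subst₂′ : ∀ {a b u v} → a ≡ u → b ≡ v → Conn H (λ _ → ⊤) a b → Conn H (λ _ → ⊤) u v
  subst₂′ refl refl c = c

-- The image of `emb` is nonempty and closed under adjacency, so walks from it reach every vertex of
-- a connected graph.
component-of-connected : ∀ {C G} → Connected G → IsComponent C G → C ≅ G
component-of-connected {C} {G} conn comp = record
  { to = emb
  ; from = λ y → proj₁ (surj y)
  ; from-to = λ x → emb-inj (proj₂ (surj (emb x)))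
  ; to-from = λ y → proj₂ (surj y)
  ; pres = induced }
  where
  open IsComponent comp
  reach : ∀ {u y} → Conn G (λ _ → ⊤) (emb u) y → ∃ λ v → emb v ≡ y
  reach {u} (here _) = u , refl
  reach {u} (step _ e c) with closed u _ e
  ... | v , refl = reach c
  surj : ∀ y → ∃ λ v → emb v ≡ y
  surj y = reach (conn (emb nonempty) y)

-- An injective code of the neighbours by numbers below `D` replaces counting them. It is defined on
-- all vertices, so composition with an embedding pulls it back.
DegreeAtMost : (G : Graph) → V G → ℕ → Set
DegreeAtMost G v D = Σ (V G → ℕ) λ code →
  (∀ a → Adj G v a → code a < D) ×
  (∀ a b → Adj G v a → Adj G v b → code a ≡ code b → a ≡ b)

DegreeAtLeast : (G : Graph) → V G → ℕ → Set
DegreeAtLeast G v d = Σ (Fin d → V G) λ nbr →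
  (∀ i → Adj G v (nbr i)) × Injective _≡_ _≡_ nbr

degree-bounds : ∀ {G v d D} → DegreeAtLeast G v d → DegreeAtMost G v D → d ≤ D
degree-bounds (nbr , isNbr , nbr-inj) (code , bound , code-inj) =
  injective⇒≤ {f = λ i → fromℕ< (bound _ (isNbr i))} λ {i} {j} eq →
    nbr-inj (code-inj _ _ (isNbr i) (isNbr j) (fromℕ<-injective _ _ _ _ eq))

degreeAtMost-mono : ∀ {G v D D′} → D ≤ D′ → DegreeAtMost G v D → DegreeAtMost G v D′
degreeAtMost-mono le (code , bound , code-inj) = code , (λ a e → ≤-trans (bound a e) le) , code-inj

degreeAtMost-pull : ∀ {G H v D} (f : G ↪ H) → DegreeAtMost H (fun f v) D → DegreeAtMost G v D
degreeAtMost-pull f (code , bound , code-inj) =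
  code ∘ fun f , (λ a e → bound _ (fun-hom f _ _ e)) ,
  λ a b ea eb eq → fun-inj f (code-inj _ _ (fun-hom f _ _ ea) (fun-hom f _ _ eb) eq)

degreeAtLeast-push : ∀ {G H v d} (f : G ↪ H) → DegreeAtLeast G v d → DegreeAtLeast H (fun f v) d
degreeAtLeast-push f (nbr , isNbr , nbr-inj) =
  fun f ∘ nbr , (λ i → fun-hom f _ _ (isNbr i)) , λ eq → nbr-inj (fun-inj f eq)

-- Graphs given by a relation, and induced subgraphs.

module _ {N : ℕ} (E : Fin N → Fin N → Set) (E? : ∀ u v → Dec (E u v)) (E-irrefl : ∀ u → ¬ E u u) where

  abstract
    -- Symmetrised, so that `E` may list each edge in one direction only.
    related : Fin N → Fin N → Bool
    related u v = ⌊ E? u v ⌋ ∨ ⌊ E? v u ⌋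

    related-sym : ∀ u v → related u v ≡ related v u
    related-sym u v = ∨-comm ⌊ E? u v ⌋ ⌊ E? v u ⌋

    related-irrefl : ∀ u → related u u ≡ false
    related-irrefl u with E? u u
    ... | yes e = ⊥-elim (E-irrefl u e)
    ... | no _  = refl

    related⇒E : ∀ u v → related u v ≡ true → E u v ⊎ E v u
    related⇒E u v e with E? u v | E? v u
    ... | yes p | _     = inj₁ p
    ... | no _  | yes p = inj₂ p
    ... | no _  | no _  with () ← e

    E⇒related : ∀ {u v} → E u v → related u v ≡ true
    E⇒related {u} {v} e with E? u v
    ... | yes _ = refl
    ... | no ¬e = ⊥-elim (¬e e)

  relationGraph : Graph
  relationGraph = record { size = N ; adj = related ; sym = related-sym ; irrefl = related-irrefl }

-- An induced subgraph needs vertices numbered by `Fin card`; an enumeration of the chosen vertices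
-- without repetition supplies the numbering.
record Selection {N : ℕ} (b : Fin N → Bool) : Set where
  field
    card  : ℕ
    pick  : Fin card → Fin N
    pick-inj : Injective _≡_ _≡_ pick
    sound : ∀ i → b (pick i) ≡ true
    complete : ∀ v → b v ≡ true → ∃ λ i → pick i ≡ v

abstract
  select : ∀ {N} (b : Fin N → Bool) → Selection b
  select {zero} b = record { card = 0 ; pick = λ () ; pick-inj = λ { {()} } ; sound = λ () ; complete = λ () }
  select {suc N} b with b zero in b0 | select (b ∘ suc)
  ... | true | S = record
    { card = suc card
    ; pick = λ { zero → zero ; (suc i) → suc (pick i) }
    ; pick-inj = λ { {zero} {zero} _ → refl
                   ; {suc i} {suc j} eq → cong suc (pick-inj (Fin.suc-injective eq)) }
    ; sound = λ { zero → b0 ; (suc i) → sound i }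
    ; complete = λ { zero _ → zero , refl
                   ; (suc v) bv → suc (proj₁ (complete v bv)) , cong suc (proj₂ (complete v bv)) } }
    where open Selection S
  ... | false | S = record
    { card = card
    ; pick = suc ∘ pick
    ; pick-inj = λ eq → pick-inj (Fin.suc-injective eq)
    ; sound = sound
    ; complete = λ { zero bv → ⊥-elim (contra (trans (≡-sym bv) b0))
                   ; (suc v) bv → proj₁ (complete v bv) , cong suc (proj₂ (complete v bv)) } }
    where
    open Selection S
    contra : true ≡ false → ⊥
    contra ()

module InducedSubgraph (G : Graph) (b : V G → Bool) where
  open Selection (select b) public

  subgraph : Graph
  subgraph = record
    { size = card
    ; adj = λ i j → adj G (pick i) (pick j)
    ; sym = λ i j → sym G (pick i) (pick j)
    ; irrefl = λ i → irrefl G (pick i) }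

  inclusion : subgraph ↪ G
  inclusion = record { fun = pick ; fun-hom = λ _ _ e → e ; fun-inj = pick-inj }

  private
    lift : ∀ {x y} → Conn G (λ w → b w ≡ true) x y → ∀ i j → pick i ≡ x → pick j ≡ y →
      Conn subgraph (λ _ → ⊤) i j
    lift (here _) i j pi pj with pick-inj (trans pi (≡-sym pj))
    ... | refl = here tt
    lift (step {w = w} _ e c) i j refl pj with complete w (Conn-head c)
    ... | k , refl = step tt e (lift c k j refl pj)

  subgraph-connected : (∀ u v → b u ≡ true → b v ≡ true → Conn G (λ w → b w ≡ true) u v) →
    Connected subgraph
  subgraph-connected conn i j = lift (conn _ _ (sound i) (sound j)) i j refl refl

-- Counting preimages.

countPre-none : ∀ {n m} (f : Fin n → Fin m) x → (∀ i → f i ≢ x) → countPre f x ≡ 0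
countPre-none {zero}  f x no-pre = refl
countPre-none {suc n} f x no-pre with f zero Fin.≟ x
... | yes eq = ⊥-elim (no-pre zero eq)
... | no _   = countPre-none (f ∘ suc) x (no-pre ∘ suc)

countPre-inj : ∀ {n m} (f : Fin n → Fin m) x → Injective _≡_ _≡_ f → countPre f x ≤ 1
countPre-inj {zero}  f x f-inj = z≤n
countPre-inj {suc n} f x f-inj with f zero Fin.≟ x
... | yes eq = s≤s (≤-reflexive (countPre-none (f ∘ suc) x λ i eq′ → 0≢suc i (f-inj (trans eq (≡-sym eq′)))))
  where
  0≢suc : ∀ (i : Fin n) → zero ≢ suc i
  0≢suc i ()
... | no _   = countPre-inj (f ∘ suc) x (λ eq → Fin.suc-injective (f-inj eq))

sumFin-mono : ∀ t {g h : Fin t → ℕ} → (∀ i → g i ≤ h i) → sumFin t g ≤ sumFin t h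
sumFin-mono zero    le = z≤n
sumFin-mono (suc t) le = +-mono-≤ (le zero) (sumFin-mono t (le ∘ suc))

-- The Kronecker delta; recursion on both arguments lets `sumFin-δ` descend in step with `sumFin`.
δ : ℕ → ℕ → ℕ
δ zero    zero    = 1
δ zero    (suc _) = 0
δ (suc _) zero    = 0
δ (suc p) (suc q) = δ p q

δ-refl : ∀ p → δ p p ≡ 1
δ-refl zero    = refl
δ-refl (suc p) = δ-refl p

sumFin-zero : ∀ t → sumFin t (λ _ → 0) ≡ 0
sumFin-zero zero    = refl
sumFin-zero (suc t) = sumFin-zero t

sumFin-δ : ∀ t p → sumFin t (λ i → δ p (toℕ i)) ≤ 1
sumFin-δ zero    p       = z≤n
sumFin-δ (suc t) zero    = s≤s (≤-reflexive (sumFin-zero t))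
sumFin-δ (suc t) (suc p) = sumFin-δ t p

sumFin-+ : ∀ t (g h : Fin t → ℕ) → sumFin t (λ i → g i + h i) ≡ sumFin t g + sumFin t h
sumFin-+ zero    g h = refl
sumFin-+ (suc t) g h rewrite sumFin-+ t (g ∘ suc) (h ∘ suc) = interchange +-commutativeSemigroup (g zero) (h zero) _ _

-- Summands of a disjoint union.

summand : ∀ Gs (m : Fin (length Gs)) → V (lookup Gs m) → V (⨁ Gs)
summand (G ∷ Gs) zero    a = a ↑ˡ size (⨁ Gs)
summand (G ∷ Gs) (suc m) a = size G ↑ʳ summand Gs m a

summand-adj : ∀ Gs m a b → adj (⨁ Gs) (summand Gs m a) (summand Gs m b) ≡ adj (lookup Gs m) a b
summand-adj (G ∷ Gs) zero a b
  rewrite splitAt-↑ˡ (size G) a (size (⨁ Gs)) | splitAt-↑ˡ (size G) b (size (⨁ Gs)) = refl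
summand-adj (G ∷ Gs) (suc m) a b
  rewrite splitAt-↑ʳ (size G) (size (⨁ Gs)) (summand Gs m a)
        | splitAt-↑ʳ (size G) (size (⨁ Gs)) (summand Gs m b) = summand-adj Gs m a b

summand-inj : ∀ Gs m → Injective _≡_ _≡_ (summand Gs m)
summand-inj (G ∷ Gs) zero    eq = ↑ˡ-injective (size (⨁ Gs)) _ _ eq
summand-inj (G ∷ Gs) (suc m) eq = summand-inj Gs m (↑ʳ-injective (size G) _ _ eq)

summand-↪ : ∀ Gs m → lookup Gs m ↪ ⨁ Gs
summand-↪ Gs m = record
  { fun = summand Gs m
  ; fun-hom = λ a b e → trans (summand-adj Gs m a b) e
  ; fun-inj = summand-inj Gs m }

↑ˡ≢↑ʳ : ∀ {m n} (a : Fin m) (b : Fin n) → a ↑ˡ n ≢ m ↑ʳ b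
↑ˡ≢↑ʳ {m} {n} a b eq
  with () ← trans (≡-sym (splitAt-↑ˡ m a n)) (trans (cong (splitAt m) eq) (splitAt-↑ʳ m n b))

summand-disjoint : ∀ Gs m m′ a a′ → summand Gs m a ≡ summand Gs m′ a′ → m ≡ m′
summand-disjoint (G ∷ Gs) zero    zero     a a′ eq = refl
summand-disjoint (G ∷ Gs) zero    (suc m′) a a′ eq = ⊥-elim (↑ˡ≢↑ʳ a _ eq)
summand-disjoint (G ∷ Gs) (suc m) zero     a a′ eq = ⊥-elim (↑ˡ≢↑ʳ a′ _ (≡-sym eq))
summand-disjoint (G ∷ Gs) (suc m) (suc m′) a a′ eq =
  cong suc (summand-disjoint Gs m m′ a a′ (↑ʳ-injective (size G) _ _ eq))

summand-vertex : ∀ Gs u → ∃₂ λ m a → summand Gs m a ≡ u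
summand-vertex (G ∷ Gs) u with splitAt (size G) u in eq
... | inj₁ a = zero , a , splitAt⁻¹-↑ˡ eq
... | inj₂ w with summand-vertex Gs w
...   | m , a , refl = suc m , a , splitAt⁻¹-↑ʳ eq

summand-closed : ∀ Gs m a v → Adj (⨁ Gs) (summand Gs m a) v → ∃ λ b → summand Gs m b ≡ v
summand-closed (G ∷ Gs) zero a v e
  rewrite splitAt-↑ˡ (size G) a (size (⨁ Gs)) with splitAt (size G) v in eq
... | inj₁ b = b , splitAt⁻¹-↑ˡ eq
... | inj₂ _ with () ← e
summand-closed (G ∷ Gs) (suc m) a v e
  rewrite splitAt-↑ʳ (size G) (size (⨁ Gs)) (summand Gs m a) with splitAt (size G) v in eq
... | inj₁ _ with () ← e
... | inj₂ w with summand-closed Gs m a w e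
...   | b , refl = b , splitAt⁻¹-↑ʳ eq

singleton-≅ : ∀ G → ⨁ (G ∷ []) ≅ G
singleton-≅ G = record
  { to = λ x → left (splitAt (size G) x)
  ; from = _↑ˡ 0
  ; from-to = from-to′
  ; to-from = λ y → cong left (splitAt-↑ˡ (size G) y 0)
  ; pres = pres′ }
  where
  left : V G ⊎ Fin 0 → V G
  left (inj₁ a) = a
  from-to′ : ∀ x → left (splitAt (size G) x) ↑ˡ 0 ≡ x
  from-to′ x with splitAt (size G) x in eq
  ... | inj₁ a = splitAt⁻¹-↑ˡ eq
  pres′ : ∀ u v → adj (⨁ (G ∷ [])) u v ≡ adj G (left (splitAt (size G) u)) (left (splitAt (size G) v))
  pres′ u v with splitAt (size G) u | splitAt (size G) v
  ... | inj₁ a | inj₁ b = refl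

-- Lexicographic order and crossings of row edges.

<ᵇ-true : ∀ {m n} → m < n → (m <ᵇ n) ≡ true
<ᵇ-true {m} {n} lt with m <ᵇ n | <⇒<ᵇ lt
... | true | _ = refl

<ᵇ-false : ∀ {m n} → n ≤ m → (m <ᵇ n) ≡ false
<ᵇ-false {m} {n} le with m <ᵇ n in eq
... | false = refl
... | true  = ⊥-elim (<-irrefl refl (≤-trans (<ᵇ⇒< m n (subst T (≡-sym eq) tt)) le))

≡ᵇ-refl : ∀ m → (m ≡ᵇ m) ≡ true
≡ᵇ-refl zero    = refl
≡ᵇ-refl (suc m) = ≡ᵇ-refl m

≡ᵇ-false : ∀ {m n} → m ≢ n → (m ≡ᵇ n) ≡ false
≡ᵇ-false {m} {n} ne with m ≡ᵇ n in eq
... | false = refl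
... | true  = ⊥-elim (ne (≡ᵇ⇒≡ m n (subst T (≡-sym eq) tt)))

lex : ℕ → ℕ → ℕ → ℕ → Bool
lex x y x′ y′ = (x <ᵇ x′) ∨ ((x ≡ᵇ x′) ∧ (y <ᵇ y′))

lex-< : ∀ {x x′} y y′ → x < x′ → lex x y x′ y′ ≡ true
lex-< y y′ lt rewrite <ᵇ-true lt = refl

lex-> : ∀ {x x′} y y′ → x′ < x → lex x y x′ y′ ≡ false
lex-> {x} {x′} y y′ gt rewrite <ᵇ-false (<⇒≤ gt) | ≡ᵇ-false {x} {x′} (λ { refl → <-irrefl refl gt }) = refl

lex-≡ : ∀ x y y′ → lex x y x y′ ≡ (y <ᵇ y′)
lex-≡ x y y′ rewrite <ᵇ-false (≤-refl {x}) | ≡ᵇ-refl x = refl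

lex-≢ : ∀ {x x′} y y′ z → x ≢ x′ → lex x y x′ z ≡ lex x y′ x′ z
lex-≢ y y′ z ne rewrite ≡ᵇ-false ne = refl

lex-asym : ∀ x y x′ y′ → ¬ (x ≡ x′ × y ≡ y′) → lex x′ y′ x y ≡ not (lex x y x′ y′)
lex-asym x y x′ y′ ne with <-cmp x x′
... | tri< lt _ _ = trans (lex-> y′ y lt) (cong not (≡-sym (lex-< y y′ lt)))
... | tri> _ _ gt = trans (lex-< y′ y gt) (cong not (≡-sym (lex-> y y′ gt)))
... | tri≈ _ refl _ with <-cmp y y′
...   | tri≈ _ refl _ = ⊥-elim (ne (refl , refl))
...   | tri< lt _ _ = trans (trans (lex-≡ x y′ y) (<ᵇ-false (<⇒≤ lt)))
                        (cong not (≡-sym (trans (lex-≡ x y y′) (<ᵇ-true lt))))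
...   | tri> _ _ gt = trans (trans (lex-≡ x y′ y) (<ᵇ-true gt))
                        (cong not (≡-sym (trans (lex-≡ x y y′) (<ᵇ-false (<⇒≤ gt)))))

-- In lexicographic order the only vertices between (x , y) and (x + 1 , y) are
-- those above the first endpoint and those below the second one; the edge runs
-- above the latter.
passesAbove : ℕ → ℕ → ℕ → ℕ → Bool
passesAbove x y u v = (u ≡ᵇ suc x) ∧ (v <ᵇ y)

-- Only edges starting in the same or in consecutive columns interact. In the same column their ends
-- always interlace, and the higher edge passes above the right end of the lower one. In consecutive
-- columns the ends interlace exactly when the left edge passes above the left end of the right
-- edge.
right-right : ∀ x y x′ y′ → ¬ (x ≡ x′ × y ≡ y′) → ¬ (suc x ≡ x′ × y ≡ y′) →
  (passesAbove x y x′ y′ xor passesAbove x y (suc x′) y′) xor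
  (passesAbove x′ y′ x y xor passesAbove x′ y′ (suc x) y)
  ≡ (lex x y x′ y′ xor lex (suc x) y x′ y′) xor (lex x y (suc x′) y′ xor lex (suc x) y (suc x′) y′)
right-right x y x′ y′ ac bc with <-cmp x x′
right-right x y x′ y′ ac bc | tri≈ _ refl _
  rewrite ≡ᵇ-false {x} {suc x} (λ e → 1+n≢n (≡-sym e)) | ≡ᵇ-refl x
        | lex-> {suc x} {x} y y′ ≤-refl | <ᵇ-true (n<1+n x) | <ᵇ-false (≤-refl {x})
  with <-cmp y y′
... | tri≈ _ refl _ = ⊥-elim (ac (refl , refl))
... | tri< lt _ _ rewrite <ᵇ-true lt | <ᵇ-false (<⇒≤ lt) = refl
... | tri> _ _ gt rewrite <ᵇ-true gt | <ᵇ-false (<⇒≤ gt) = refl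
right-right x y x′ y′ ac bc | tri< lt _ _
  rewrite ≡ᵇ-false {x} {suc x′} (<⇒≢ (m<n⇒m<1+n lt)) | ≡ᵇ-false (<⇒≢ lt) | ≡ᵇ-false (>⇒≢ lt)
        | <ᵇ-true lt | <ᵇ-true (m<n⇒m<1+n lt)
  with m≤n⇒m<n∨m≡n lt
... | inj₁ lt′ rewrite ≡ᵇ-false (<⇒≢ lt′) | ≡ᵇ-false (>⇒≢ lt′) | <ᵇ-true lt′ = refl
... | inj₂ refl rewrite ≡ᵇ-refl x | <ᵇ-false (≤-refl {x})
  with <-cmp y y′
...   | tri≈ _ refl _ = ⊥-elim (bc (refl , refl))
...   | tri< l _ _ rewrite <ᵇ-true l | <ᵇ-false (<⇒≤ l) = refl
...   | tri> _ _ g rewrite <ᵇ-true g | <ᵇ-false (<⇒≤ g) = refl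
right-right x y x′ y′ ac bc | tri> _ _ gt
  rewrite ≡ᵇ-false {x′} {suc x} (<⇒≢ (m<n⇒m<1+n gt)) | ≡ᵇ-false {suc x} {x′} (>⇒≢ (m<n⇒m<1+n gt)) | ≡ᵇ-false (<⇒≢ gt) | ≡ᵇ-false (>⇒≢ gt)
        | <ᵇ-false (<⇒≤ gt) | <ᵇ-false (≤-trans (<⇒≤ gt) (n≤1+n x))
  with m≤n⇒m<n∨m≡n gt
... | inj₁ gt′ rewrite ≡ᵇ-false (>⇒≢ gt′) | <ᵇ-false (<⇒≤ gt′) = refl
... | inj₂ refl rewrite ≡ᵇ-refl x′ | <ᵇ-false (≤-refl {x′}) = refl

-- Bipartitions and neighbour codes.

odd : ℕ → Bool
odd zero    = false
odd (suc m) = not (odd m)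

Bipartition : (G : Graph) → (V G → Bool) → Set
Bipartition G χ = ∀ u v → Adj G u v → χ v ≡ not (χ u)

bipartition-pull : ∀ {G H χ} (f : G ↪ H) → Bipartition H χ → Bipartition G (χ ∘ fun f)
bipartition-pull f bip u v e = bip _ _ (fun-hom f u v e)

-- Both colours flip along every edge, so their `xor` is constant along a walk.
bipartitions-agree : ∀ {G P χ χ′} → Bipartition G χ → Bipartition G χ′ →
  ∀ {u v} → Conn G P u v → χ u xor χ′ u ≡ χ v xor χ′ v
bipartitions-agree bip bip′ (here _) = refl
bipartitions-agree {χ = χ} {χ′} bip bip′ (step {u} {w} _ e c) =
  trans (≡-sym (trans (cong₂ _xor_ (bip u w e) (bip′ u w e)) (xor-not-not (χ u) (χ′ u))))
    (bipartitions-agree bip bip′ c)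
  where
  xor-not-not : ∀ a b → not a xor not b ≡ a xor b
  xor-not-not false false = refl
  xor-not-not false true  = refl
  xor-not-not true  false = refl
  xor-not-not true  true  = refl

-- Numbers known to exist for neighbours only become a total code because adjacency is decidable.
degreeAtMost-by : ∀ {G v D} (R : V G → ℕ → Set) →
  (∀ a → Adj G v a → ∃ λ m → m < D × R a m) → (∀ a b m → R a m → R b m → a ≡ b) →
  DegreeAtMost G v D
degreeAtMost-by {G} {v} {D} R total functional = code ,
  (λ a e → proj₁ (code-spec a e)) ,
  λ a b ea eb eq → functional a b _ (proj₂ (code-spec a ea)) (subst (R b) (≡-sym eq) (proj₂ (code-spec b eb)))
  where
  pickCode : ∀ a → Dec (Adj G v a) → ℕ
  pickCode a (yes e) = proj₁ (total a e)
  -- The default is harmless: both conditions on a code concern neighbours only.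
  pickCode a (no _)  = 0
  code : V G → ℕ
  code a = pickCode a (adj G v a Bool.≟ true)
  code-spec : ∀ a → Adj G v a → code a < D × R a (code a)
  code-spec a e with adj G v a Bool.≟ true
  ... | yes e′ = proj₂ (total a e′)
  ... | no ¬e  = ⊥-elim (¬e e)

does⇒ : ∀ {A : Set} (d : Dec A) → does d ≡ true → A
does⇒ (yes a) _ = a

-- The hairy grid.

-- The rows are the heights y < n; the vertex (x , n) ends column x, the
-- vertices with n < y ≤ n + ℓ x are leaves attached to it, and those with
-- y > n + ℓ x are isolated.
module HairyGrid (n w c : ℕ) (ℓ : Fin w → ℕ) (ℓ≤c : ∀ x → ℓ x ≤ c) where

  height : ℕ
  height = suc n + c

  Vertex : Set
  Vertex = Fin (w * height)

  abstract
    col : Vertex → Fin w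
    col v = proj₁ (remQuot height v)

    Y : Vertex → ℕ
    Y v = toℕ (proj₂ (remQuot {w} height v))

    vertex : Fin w → ∀ {y} → y < height → Vertex
    vertex x y< = combine x (fromℕ< y<)

    col-vertex : ∀ x {y} (y< : y < height) → col (vertex x y<) ≡ x
    col-vertex x y< = cong proj₁ (remQuot-combine x (fromℕ< y<))

    Y-vertex : ∀ x {y} (y< : y < height) → Y (vertex x y<) ≡ y
    Y-vertex x y< = trans (cong (toℕ ∘ proj₂) (remQuot-combine x (fromℕ< y<))) (toℕ-fromℕ< y<)

    vertex-unique : ∀ {u v} → col u ≡ col v → Y u ≡ Y v → u ≡ v
    vertex-unique {u} {v} cu yu = trans (≡-sym (combine-remQuot {w} height u))
      (trans (cong₂ combine cu (toℕ-injective yu)) (combine-remQuot {w} height v))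

  X : Vertex → ℕ
  X v = toℕ (col v)

  vertex-unique′ : ∀ {u v} → X u ≡ X v → Y u ≡ Y v → u ≡ v
  vertex-unique′ xu = vertex-unique (toℕ-injective xu)

  -- Row edges stay strictly below height `n`, so a column end has no horizontal edge. Columns with
  -- `ℓ` equal to 0 get no vertical edges at all, and thus need no piece besides the rows.
  Right Up Leaf Column Edge : Vertex → Vertex → Set
  Right u v  = suc (X u) ≡ X v × Y u ≡ Y v × Y u < n
  Up u v     = suc (Y u) ≡ Y v × Y v ≤ n
  Leaf u v   = Y u ≡ n × n < Y v × Y v ≤ n + ℓ (col u)
  Column u v = col u ≡ col v × 0 < ℓ (col u) × (Up u v ⊎ Leaf u v)
  Edge u v   = Right u v ⊎ Column u v

  edge? : ∀ u v → Dec (Edge u v)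
  edge? u v =
    (suc (X u) ≟ X v ×-dec Y u ≟ Y v ×-dec Y u <? n) ⊎-dec
    (col u Fin.≟ col v ×-dec 0 <? ℓ (col u) ×-dec
      ((suc (Y u) ≟ Y v ×-dec Y v ≤? n) ⊎-dec (Y u ≟ n ×-dec n <? Y v ×-dec Y v ≤? n + ℓ (col u))))

  edge-irrefl : ∀ u → ¬ Edge u u
  edge-irrefl u (inj₁ (e , _))                           = 1+n≢n e
  edge-irrefl u (inj₂ (_ , _ , inj₁ (e , _)))            = 1+n≢n e
  edge-irrefl u (inj₂ (_ , _ , inj₂ (yn , lt , _)))      = <⇒≢ lt (≡-sym yn)

  grid : Graph
  grid = relationGraph Edge edge? edge-irrefl

  edge : ∀ {u v} → Edge u v → Adj grid u v
  edge = E⇒related Edge edge? edge-irrefl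

  Adj⇒Edge : ∀ {u v} → Adj grid u v → Edge u v ⊎ Edge v u
  Adj⇒Edge = related⇒E Edge edge? edge-irrefl _ _

  -- Drawing, two-colouring and outer face of the hairy grid.

  before : Vertex → Vertex → Bool
  before u v = lex (X u) (Y u) (X v) (Y v)

  -- The guard singles out rightward steps. Column edges therefore pass above nothing, and for a row
  -- edge one of the two summands vanishes, whichever way it is traversed.
  aboveRight above : Vertex → Vertex → Vertex → Bool
  aboveRight a b v = (suc (X a) ≡ᵇ X b) ∧ passesAbove (X a) (Y a) (X v) (Y v)
  above a b v = aboveRight a b v xor aboveRight b a v

  before-asym : ∀ {a b} → a ≢ b → before b a ≡ not (before a b)
  before-asym {a} {b} a≢b = lex-asym (X a) (Y a) (X b) (Y b) λ (p , q) → a≢b (vertex-unique′ p q)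

  private
    interlace : Vertex → Vertex → Vertex → Vertex → Bool
    interlace a b c d = (before a c xor before b c) xor (before a d xor before b d)

    NonCrossing : Vertex → Vertex → Vertex → Vertex → Set
    NonCrossing a b c d =
      (above a b c xor above a b d) xor (above c d a xor above c d b) ≡ interlace a b c d

    Disjoint : Vertex → Vertex → Vertex → Vertex → Set
    Disjoint a b c d = a ≢ c × a ≢ d × b ≢ c × b ≢ d

    disjoint-sym : ∀ {a b c d} → Disjoint a b c d → Disjoint c d a b
    disjoint-sym (ac , ad , bc , bd) = ≢-sym ac , ≢-sym bc , ≢-sym ad , ≢-sym bd

    interlace-sym : ∀ {a b c d} → Disjoint a b c d → interlace c d a b ≡ interlace a b c d
    interlace-sym {a} {b} {c} {d} (ac , ad , bc , bd)
      rewrite before-asym ac | before-asym ad | before-asym bc | before-asym bd =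
      solve 4 (λ ac ad bc bd →
        ((con true :+ ac) :+ (con true :+ ad)) :+ ((con true :+ bc) :+ (con true :+ bd))
        := (ac :+ bc) :+ (ad :+ bd)) refl (before a c) (before a d) (before b c) (before b d)
      where open xor-∧-Solver

    nonCrossing-sym : ∀ {a b c d} → Disjoint a b c d → NonCrossing c d a b → NonCrossing a b c d
    nonCrossing-sym {a} {b} {c} {d} dis nc =
      trans (xor-comm (above a b c xor above a b d) _) (trans nc (interlace-sym dis))

    nonCrossing-flip : ∀ {a b c d} → NonCrossing b a c d → NonCrossing a b c d
    nonCrossing-flip {a} {b} {c} {d} nc = begin
      (above a b c xor above a b d) xor (above c d a xor above c d b)
        ≡⟨ cong₂ _xor_ (cong₂ _xor_ (xor-comm (aboveRight a b c) _) (xor-comm (aboveRight a b d) _))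
                       (xor-comm (above c d a) _) ⟩
      (above b a c xor above b a d) xor (above c d b xor above c d a)
        ≡⟨ nc ⟩
      interlace b a c d
        ≡⟨ cong₂ _xor_ (xor-comm (before b c) _) (xor-comm (before b d) _) ⟩
      interlace a b c d ∎
      where open ≡-Reasoning

    above-right : ∀ {a b} → Right a b → ∀ v → above a b v ≡ passesAbove (X a) (Y a) (X v) (Y v)
    above-right {a} {b} (eq , _) v
      rewrite ≡-sym eq | ≡ᵇ-refl (X a) | ≡ᵇ-false {suc (suc (X a))} {X a} (>⇒≢ (m<n⇒m<1+n ≤-refl))
      = xor-identityʳ _

    above-column : ∀ {a b} → Column a b → ∀ v → above a b v ≡ false
    above-column {a} {b} (eq , _) v rewrite ≡-sym eq | ≡ᵇ-false {suc (X a)} {X a} 1+n≢n = refl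

    -- An upward edge joins consecutive heights, and a leaf edge lies entirely at heights at least
    -- `n`; neither has a height `z ≤ n` strictly between its ends.
    column-height : ∀ {a b} → Column a b → ∀ {z} → Y a ≢ z → Y b ≢ z → z ≤ n →
      (Y a <ᵇ z) ≡ (Y b <ᵇ z)
    column-height {a} {b} (_ , _ , inj₁ (eq , _)) {z} az bz z≤n′ with <-cmp (Y a) z
    ... | tri≈ _ p _ = ⊥-elim (az p)
    ... | tri< lt _ _ = trans (<ᵇ-true lt)
            (≡-sym (<ᵇ-true (≤∧≢⇒< (subst (_≤ z) eq lt) bz)))
    ... | tri> _ _ gt = trans (<ᵇ-false (<⇒≤ gt))
            (≡-sym (<ᵇ-false (≤-trans (<⇒≤ gt) (≤-trans (n≤1+n _) (≤-reflexive eq)))))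
    column-height (_ , _ , inj₂ (yn , lt , _)) az bz z≤n′ =
      trans (<ᵇ-false (≤-trans z≤n′ (≤-reflexive (≡-sym yn)))) (≡-sym (<ᵇ-false (≤-trans z≤n′ (<⇒≤ lt))))

    -- Lexicographically, only vertices of the same column lie between the ends of a column edge,
    -- and among these only leaves can; `far` excludes exactly that case.
    column-before : ∀ {a b} → Column a b → ∀ {p} → a ≢ p → b ≢ p → col a ≢ col p ⊎ Y p ≤ n →
      before a p ≡ before b p
    column-before {a} {b} e@(eq , _) {p} ap bp far with col a Fin.≟ col p
    ... | no ne = trans (lex-≢ (Y a) (Y b) (Y p) (ne ∘ toℕ-injective))
                        (cong (λ x → lex (toℕ x) (Y b) (X p) (Y p)) eq)
    ... | yes same with far
    ...   | inj₁ ne = ⊥-elim (ne same)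
    ...   | inj₂ le = begin
      before a p                    ≡⟨ cong (λ x → lex (toℕ x) (Y a) (X p) (Y p)) same ⟩
      lex (X p) (Y a) (X p) (Y p)   ≡⟨ lex-≡ (X p) (Y a) (Y p) ⟩
      (Y a <ᵇ Y p)                  ≡⟨ column-height e (λ q → ap (vertex-unique same q))
                                         (λ q → bp (vertex-unique same′ q)) le ⟩
      (Y b <ᵇ Y p)                  ≡⟨ lex-≡ (X p) (Y b) (Y p) ⟨
      lex (X p) (Y b) (X p) (Y p)   ≡⟨ cong (λ x → lex (toℕ x) (Y b) (X p) (Y p)) same′ ⟨
      before b p                    ∎
      where
      open ≡-Reasoning
      same′ : col b ≡ col p
      same′ = trans (≡-sym eq) same

    column-interlace : ∀ {a b c d} → Column a b → Disjoint a b c d →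
      col a ≢ col c ⊎ Y c ≤ n → col a ≢ col d ⊎ Y d ≤ n → interlace a b c d ≡ false
    column-interlace {a} {b} {c} {d} e (ac , ad , bc , bd) farc fard
      rewrite column-before e ac bc farc | column-before e ad bd fard
            | xor-same (before b c) | xor-same (before b d) = refl

    -- Column edges pass above nothing, so `interlace` must vanish. Only leaves can separate the
    -- ends of a column edge, and two leaf edges of one column share its end. Hence one of two
    -- disjoint edges does not separate the other, and `interlace` is symmetric.
    column-column : ∀ {a b c d} → Column a b → Column c d → Disjoint a b c d → NonCrossing a b c d
    column-column {a} {b} {c} {d} e f dis@(ac , ad , bc , bd)
      rewrite above-column e c | above-column e d | above-column f a | above-column f b =
      ≡-sym (go (col a Fin.≟ col c) e f)
      where
      go : Dec (col a ≡ col c) → Column a b → Column c d → interlace a b c d ≡ false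
      go _ e (cd , _ , inj₁ (eq , le)) =
        column-interlace e dis (inj₂ (≤-trans (n≤1+n _) (≤-trans (≤-reflexive eq) le))) (inj₂ le)
      go (no ne) e (cd , _ , inj₂ _) =
        column-interlace e dis (inj₁ ne) (inj₁ λ p → ne (trans p (≡-sym cd)))
      go (yes same) (_ , _ , inj₂ (ya , _)) (_ , _ , inj₂ (yc , _)) =
        ⊥-elim (ac (vertex-unique same (trans ya (≡-sym yc))))
      go (yes same) e@(_ , _ , inj₁ (eq , le)) (_ , _ , inj₂ _) =
        trans (≡-sym (interlace-sym dis))
          (column-interlace f (disjoint-sym dis)
            (inj₂ (≤-trans (n≤1+n _) (≤-trans (≤-reflexive eq) le))) (inj₂ le))

    -- Both ends of the column edge lie on the same side of the row, so the row edge passes above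
    -- both or neither; its own ends are too low to be leaves, so nothing interlaces.
    column-right : ∀ {a b c d} → Column a b → Right c d → Disjoint a b c d → NonCrossing a b c d
    column-right {a} {b} {c} {d} e@(ab , _) f@(cd , ycd , yc<) dis@(ac , ad , bc , bd)
      rewrite above-column e c | above-column e d | above-right f a | above-right f b
            | column-interlace e dis (inj₂ (<⇒≤ yc<)) (inj₂ (subst (_≤ n) ycd (<⇒≤ yc<))) | ≡-sym ab
      with X a ≟ suc (X c)
    ... | no ne rewrite ≡ᵇ-false ne = refl
    ... | yes eq rewrite column-height e {Y c}
            (λ q → ad (vertex-unique′ (trans eq cd) (trans q ycd)))
            (λ q → bd (vertex-unique′ (trans (cong toℕ (≡-sym ab)) (trans eq cd)) (trans q ycd))) (<⇒≤ yc<) =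
            xor-same ((X a ≡ᵇ suc (X c)) ∧ (Y b <ᵇ Y c))

    right-right′ : ∀ {a b c d} → Right a b → Right c d → Disjoint a b c d → NonCrossing a b c d
    right-right′ {a} {b} {c} {d} e@(ab , yab , _) f@(cd , ycd , _) (ac , ad , bc , bd)
      rewrite above-right e c | above-right e d | above-right f a | above-right f b
            | ≡-sym ab | ≡-sym cd | ≡-sym yab | ≡-sym ycd =
      right-right (X a) (Y a) (X c) (Y c) (λ (p , q) → ac (vertex-unique′ p q))
        λ (p , q) → bc (vertex-unique′ (trans (≡-sym ab) p) (trans (≡-sym yab) q))

    edge-edge : ∀ {a b c d} → Edge a b → Edge c d → Disjoint a b c d → NonCrossing a b c d
    edge-edge (inj₁ e) (inj₁ f) dis = right-right′ e f dis
    edge-edge (inj₁ e) (inj₂ f) dis = nonCrossing-sym dis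
      (column-right f e (disjoint-sym dis))
    edge-edge (inj₂ e) (inj₁ f) dis = column-right e f dis
    edge-edge (inj₂ e) (inj₂ f) dis = column-column e f dis

    edge-adj : ∀ {a b c d} → Edge a b → Adj grid c d → Disjoint a b c d → NonCrossing a b c d
    edge-adj e f dis@(ac , ad , bc , bd) with Adj⇒Edge f
    ... | inj₁ f′ = edge-edge e f′ dis
    ... | inj₂ f′ = nonCrossing-sym dis (nonCrossing-flip (nonCrossing-sym
                      (disjoint-sym (ad , ac , bd , bc))
                      (edge-edge e f′ (ad , ac , bd , bc))))

  drawing : Drawing grid
  drawing = record
    { before = before
    ; above = above
    ; before-asym = before-asym
    ; noncrossing = λ e f ac ad bc bd → case Adj⇒Edge e of λ where
        (inj₁ e′) → edge-adj e′ f (ac , ad , bc , bd)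
        (inj₂ e′) → nonCrossing-flip (edge-adj e′ f (bc , bd , ac , ad))
    }

  -- Truncation at `suc n` gives every leaf the height just above its column end, so leaf edges too
  -- join opposite colours.
  color : Vertex → Bool
  color v = odd (X v + Y v ⊓ suc n)

  color-bipartition : Bipartition grid color
  color-bipartition u v e = case Adj⇒Edge e of λ where
      (inj₁ e′) → edge-color e′
      (inj₂ e′) → trans (≡-sym (not-involutive (color v))) (cong not (≡-sym (edge-color e′)))
    where
    edge-color : ∀ {u v} → Edge u v → color v ≡ not (color u)
    edge-color {u} {v} (inj₁ (x , y , _)) = cong odd (cong₂ (λ a b → a + b ⊓ suc n) (≡-sym x) (≡-sym y))
    edge-color {u} {v} (inj₂ (x , _ , inj₁ (y , le))) = trans
      (cong odd (trans (cong₂ _+_ (cong toℕ (≡-sym x)) (m≤n⇒m⊓n≡m (m≤n⇒m≤1+n le)))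
        (trans (cong (X u +_) (≡-sym y)) (+-suc (X u) (Y u)))))
      (cong (λ h → not (odd (X u + h))) (≡-sym (m≤n⇒m⊓n≡m
        (≤-trans (n≤1+n (Y u)) (≤-trans (≤-reflexive y) (m≤n⇒m≤1+n le))))))
    edge-color {u} {v} (inj₂ (x , _ , inj₂ (y , lt , _))) = trans
      (cong odd (trans (cong₂ _+_ (cong toℕ (≡-sym x)) (m≥n⇒m⊓n≡n lt)) (+-suc (X u) n)))
      (cong (λ h → not (odd (X u + h))) (≡-sym (trans (cong (_⊓ suc n) y) (m≤n⇒m⊓n≡m (n≤1+n n)))))

  color-top : ∀ {v} → Y v ≡ n → color v ≡ odd (X v + n)
  color-top {v} y = cong (λ h → odd (X v + h)) (trans (cong (_⊓ suc n) y) (m≤n⇒m⊓n≡m (n≤1+n n)))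

  -- This places the column ends on the outer face: row edges lie below height `n` and pass only
  -- above vertices lower than themselves.
  above-top : ∀ {a b v} → Adj grid a b → Y v ≡ n → above a b v ≡ false
  above-top {a} {b} {v} e y = case Adj⇒Edge e of λ where
      (inj₁ e′) → go e′
      (inj₂ e′) → trans (xor-comm (aboveRight a b v) _) (go e′)
    where
    go : ∀ {a b} → Edge a b → above a b v ≡ false
    go {a} (inj₁ f@(_ , _ , le)) = trans (above-right f v)
      (trans (cong ((X v ≡ᵇ suc (X a)) ∧_) (<ᵇ-false (≤-trans (<⇒≤ le) (≤-reflexive (≡-sym y))))) (∧-zeroʳ _))
    go (inj₂ f) = above-column f v

  open Crossing drawing

  aboveWalk-top : ∀ {P a b v} (p : Conn grid P a b) → Y v ≡ n → aboveWalk p v ≡ false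
  aboveWalk-top (here _)     y = refl
  aboveWalk-top (step _ e p) y = cong₂ _xor_ (above-top e y) (aboveWalk-top p y)

  -- For ends on the outer face all `above` terms of `walk-walk` vanish, whereas the order of the
  -- columns makes `interlace` true.
  interlaced-walks-meet : ∀ {P Q a b c d} → Conn grid P a b → Conn grid Q c d →
    Y a ≡ n → Y b ≡ n → Y c ≡ n → Y d ≡ n → X a < X c → X c < X b → X b < X d →
    ¬ (∀ v → P v → ¬ Q v)
  interlaced-walks-meet {a = a} {b} {c} {d} p q ya yb yc yd ac cb bd disj
    with walk-walk p q disj
  ... | eq rewrite aboveWalk-top p yc | aboveWalk-top p yd | aboveWalk-top q ya | aboveWalk-top q yb
                 | lex-< (Y a) (Y c) ac | lex-> (Y b) (Y c) cb
                 | lex-< (Y a) (Y d) (<-trans ac (<-trans cb bd)) | lex-< (Y b) (Y d) bd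
    with () ← eq

  -- Degrees in the hairy grid.

  private
    -- The numbers 0 to 3 stand for left, right, down and up, and `4 + m` for the leaf at height
    -- `suc n + m`. The truncation in direction 2 makes the column end the lower neighbour of each
    -- of its leaves.
    Direction : Vertex → Vertex → ℕ → Set
    Direction v a 0 = suc (X a) ≡ X v × Y a ≡ Y v
    Direction v a 1 = X a ≡ suc (X v) × Y a ≡ Y v
    Direction v a 2 = col a ≡ col v × suc (Y a) ≡ Y v ⊓ suc n
    Direction v a 3 = col a ≡ col v × Y a ≡ suc (Y v)
    Direction v a (suc (suc (suc (suc m)))) = col a ≡ col v × Y a ≡ suc n + m

    direction-unique : ∀ v a b m → Direction v a m → Direction v b m → a ≡ b
    direction-unique v a b 0 (x , y) (x′ , y′) = vertex-unique′ (suc-injective (trans x (≡-sym x′))) (trans y (≡-sym y′))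
    direction-unique v a b 1 (x , y) (x′ , y′) = vertex-unique′ (trans x (≡-sym x′)) (trans y (≡-sym y′))
    direction-unique v a b 2 (x , y) (x′ , y′) = vertex-unique (trans x (≡-sym x′)) (suc-injective (trans y (≡-sym y′)))
    direction-unique v a b 3 (x , y) (x′ , y′) = vertex-unique (trans x (≡-sym x′)) (trans y (≡-sym y′))
    direction-unique v a b (suc (suc (suc (suc m)))) (x , y) (x′ , y′) = vertex-unique (trans x (≡-sym x′)) (trans y (≡-sym y′))

    direction : ∀ v a → Adj grid v a →
      ∃ λ m → (m < 4 ⊎ Y v ≡ n × m < 4 + ℓ (col v)) × Direction v a m
    direction v a e with Adj⇒Edge e
    ... | inj₁ (inj₁ (x , y , _)) = 1 , inj₁ (s≤s (s≤s z≤n)) , ≡-sym x , ≡-sym y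
    ... | inj₂ (inj₁ (x , y , _)) = 0 , inj₁ (s≤s z≤n) , x , y
    ... | inj₁ (inj₂ (x , _ , inj₁ (y , _))) = 3 , inj₁ ≤-refl , ≡-sym x , ≡-sym y
    ... | inj₂ (inj₂ (x , _ , inj₁ (y , le))) =
      2 , inj₁ (s≤s (s≤s (s≤s z≤n))) , x , trans y (≡-sym (m≤n⇒m⊓n≡m (m≤n⇒m≤1+n le)))
    ... | inj₂ (inj₂ (x , _ , inj₂ (y , lt , _))) =
      2 , inj₁ (s≤s (s≤s (s≤s z≤n))) , x , trans (cong suc y) (≡-sym (m≥n⇒m⊓n≡n lt))
    ... | inj₁ (inj₂ (x , _ , inj₂ (y , lt , le))) =
      4 + (Y a ∸ suc n) ,
      inj₂ (y , +-monoʳ-< 4 (+-cancelˡ-< (suc n) _ _ (≤-trans (≤-reflexive (cong suc (m+[n∸m]≡n lt))) (s≤s le)))) ,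
      ≡-sym x , ≡-sym (m+[n∸m]≡n lt)

  degree-column : ∀ v → DegreeAtMost grid v (4 + ℓ (col v))
  degree-column v = degreeAtMost-by {grid} {v} (Direction v)
    (λ a e → case direction v a e of λ where
      (m , inj₁ lt , d)       → m , ≤-trans lt (m≤m+n 4 _) , d
      (m , inj₂ (_ , lt) , d) → m , lt , d)
    (direction-unique v)

  degree-non-top : ∀ v → Y v ≢ n → DegreeAtMost grid v 4
  degree-non-top v ¬top = degreeAtMost-by {grid} {v} (Direction v)
    (λ a e → case direction v a e of λ where
      (m , inj₁ lt , d)      → m , lt , d
      (m , inj₂ (y , _) , d) → ⊥-elim (¬top y))
    (direction-unique v)

  cell< : ∀ {y} → y ≤ n → y < height
  cell< le = s≤s (≤-trans le (m≤m+n n c))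

  top : Fin w → Vertex
  top x = vertex x (cell< ≤-refl)

  leaf< : ∀ x (j : Fin (ℓ x)) → suc n + toℕ j < height
  leaf< x j = s≤s (+-monoʳ-< n (≤-trans (toℕ<n j) (ℓ≤c x)))

  leaf : ∀ x → Fin (ℓ x) → Vertex
  leaf x j = vertex x (leaf< x j)

  leaf-adj : ∀ x j → Adj grid (top x) (leaf x j)
  leaf-adj x j = edge (inj₂ (trans ct (≡-sym (col-vertex x (leaf< x j))) ,
      subst (λ x → 0 < ℓ x) (≡-sym ct) (≤-trans (s≤s z≤n) (toℕ<n j)) ,
      inj₂ (Y-vertex x (cell< ≤-refl) , subst (n <_) (≡-sym yl) (s≤s (m≤m+n n _)) ,
        subst (λ y → y ≤ n + ℓ (col (top x))) (≡-sym yl)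
          (subst (λ x′ → suc n + toℕ j ≤ n + ℓ x′) (≡-sym ct) (+-monoʳ-< n (toℕ<n j))))))
    where
    ct = col-vertex x (cell< ≤-refl)
    yl = Y-vertex x (leaf< x j)

  leaf-inj : ∀ x → Injective _≡_ _≡_ (leaf x)
  leaf-inj x {i} {j} eq = toℕ-injective (+-cancelˡ-≡ (suc n) _ _
    (trans (≡-sym (Y-vertex x (leaf< x i))) (trans (cong Y eq) (Y-vertex x (leaf< x j)))))

  -- The pieces and the cover they form.

  module Pieces (owner : Fin w → Fin n) (root : Fin w) (root≡0 : toℕ root ≡ 0) where

    -- The bound `n + ℓ (col v)` leaves out the isolated vertices that fill a column up to `height`;
    -- with them a piece would be disconnected.
    InPiece : Fin n → Vertex → Set
    InPiece i v = Y v ≡ toℕ i ⊎ (0 < ℓ (col v) × owner (col v) ≡ i × Y v ≤ n + ℓ (col v))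

    inPiece? : ∀ i v → Dec (InPiece i v)
    inPiece? i v = (Y v ≟ toℕ i) ⊎-dec
      (0 <? ℓ (col v) ×-dec owner (col v) Fin.≟ i ×-dec Y v ≤? n + ℓ (col v))

    module Piece (i : Fin n) = InducedSubgraph grid (λ v → does (inPiece? i v))

    piece : Fin n → Graph
    piece i = Piece.subgraph i

    private
      i≤n : ∀ (i : Fin n) → toℕ i ≤ n
      i≤n i = <⇒≤ (toℕ<n i)

      origin : Fin n → Vertex
      origin i = vertex root (cell< (i≤n i))

      row-walk : ∀ i m v → X v ≡ m → Y v ≡ toℕ i → Conn grid (InPiece i) v (origin i)
      row-walk i zero v x y = subst (Conn grid (InPiece i) v)
        (vertex-unique′ (trans x (≡-sym (trans (cong toℕ (col-vertex root (cell< (i≤n i)))) root≡0)))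
          (trans y (≡-sym (Y-vertex root (cell< (i≤n i)))))) (here (inj₁ y))
      row-walk i (suc m) v x y = step (inj₁ y)
        (trans (sym grid v v′) (edge (inj₁ (trans (cong suc xv′) (≡-sym x) , trans yv′ (≡-sym y) ,
          subst (_< n) (≡-sym yv′) (toℕ<n i)))))
        (row-walk i m v′ xv′ yv′)
        where
        m<w : m < w
        m<w = ≤-trans (≤-reflexive (≡-sym x)) (<⇒≤ (toℕ<n (col v)))
        v′ = vertex (fromℕ< m<w) (cell< (i≤n i))
        xv′ : X v′ ≡ m
        xv′ = trans (cong toℕ (col-vertex (fromℕ< m<w) (cell< (i≤n i)))) (toℕ-fromℕ< m<w)
        yv′ = Y-vertex (fromℕ< m<w) (cell< (i≤n i))

      column-walk : ∀ x m v → 0 < ℓ x → col v ≡ x → Y v ≡ m → m ≤ n →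
        Conn grid (InPiece (owner x)) v (vertex x (cell< z≤n))
      column-walk x zero v pos refl y le = subst (Conn grid _ v)
        (vertex-unique (≡-sym (col-vertex x (cell< z≤n))) (trans y (≡-sym (Y-vertex x (cell< z≤n)))))
        (here (inj₂ (pos , refl , subst (_≤ n + ℓ x) (≡-sym y) z≤n)))
      column-walk x (suc m) v pos refl y le = step
        (inj₂ (pos , refl , subst (_≤ n + ℓ x) (≡-sym y) (≤-trans le (m≤m+n n _))))
        (trans (sym grid v v′) (edge (inj₂ (cv′ , subst (λ x → 0 < ℓ x) (≡-sym cv′) pos ,
          inj₁ (trans (cong suc yv′) (≡-sym y) , subst (_≤ n) (≡-sym y) le)))))
        (column-walk x m v′ pos cv′ yv′ m≤n)
        where
        m≤n = ≤-trans (n≤1+n m) le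
        v′ = vertex x (cell< m≤n)
        cv′ = col-vertex x (cell< m≤n)
        yv′ = Y-vertex x (cell< m≤n)

      -- Down to height 0, back up to the row of the owner, then left along it. The detour through
      -- height 0 lets one downward induction serve cells above and below the row.
      cell-walk : ∀ x v → 0 < ℓ x → col v ≡ x → Y v ≤ n →
        Conn grid (InPiece (owner x)) v (origin (owner x))
      cell-walk x v pos cv le = Conn-trans (column-walk x (Y v) v pos cv refl le)
        (Conn-trans (Conn-sym (column-walk x (toℕ i) u pos (col-vertex x i<) (Y-vertex x i<) (i≤n i)))
          (row-walk i _ u refl (Y-vertex x i<)))
        where
        i = owner x
        i< = cell< (i≤n i)
        u = vertex x i<

      to-origin : ∀ i v → InPiece i v → Conn grid (InPiece i) v (origin i)
      to-origin i v (inj₁ y) = row-walk i _ v refl y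
      to-origin i v p@(inj₂ (pos , refl , le)) with Y v ≤? n
      ... | yes y≤n = cell-walk (col v) v pos refl y≤n
      ... | no y≰n = step p
        (trans (sym grid v (top (col v))) (edge (inj₂ (ct , subst (λ x → 0 < ℓ x) (≡-sym ct) pos ,
          inj₂ (yt , ≰⇒> y≰n , subst (λ x → Y v ≤ n + ℓ x) (≡-sym ct) le)))))
        (cell-walk (col v) (top (col v)) pos ct (≤-reflexive yt))
        where
        ct = col-vertex (col v) (cell< ≤-refl)
        yt = Y-vertex (col v) (cell< ≤-refl)

    piece-connected : ∀ i → Connected (piece i)
    piece-connected i = Piece.subgraph-connected i λ u v pu pv →
      Conn-map (λ w p → dec-true (inPiece? i w) p)
        (Conn-trans (to-origin i u (does⇒ (inPiece? i u) pu))
          (Conn-sym (to-origin i v (does⇒ (inPiece? i v) pv))))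

    private
      covering-piece : ∀ u v → Edge u v → ∃ λ i → InPiece i u × InPiece i v
      covering-piece u v (inj₁ (_ , y , le)) = fromℕ< le ,
        inj₁ (≡-sym (toℕ-fromℕ< le)) , inj₁ (trans (≡-sym y) (≡-sym (toℕ-fromℕ< le)))
      covering-piece u v (inj₂ (x , pos , h)) = owner (col u) ,
        inj₂ (pos , refl , ≤-trans (proj₁ (heights h)) (m≤m+n n _)) ,
        inj₂ (subst (λ x → 0 < ℓ x) x pos , cong owner (≡-sym x) ,
          subst (λ x → Y v ≤ n + ℓ x) x (proj₂ (heights h)))
        where
        heights : Up u v ⊎ Leaf u v → Y u ≤ n × Y v ≤ n + ℓ (col u)
        heights (inj₁ (eq , le)) = ≤-trans (n≤1+n _) (≤-trans (≤-reflexive eq) le) , ≤-trans le (m≤m+n n _)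
        heights (inj₂ (eq , _ , le)) = ≤-reflexive eq , le

    pieces-cover : ∀ {𝒢} → (∀ i → 𝒢 (piece i)) → InjCover 𝒢 grid
    pieces-cover in𝒢 = record
      { t = n
      ; parts = piece
      ; inClass = in𝒢
      ; maps = Piece.pick
      ; hom = λ i u v e → e
      ; edgeSurj = surj
      ; inj = Piece.pick-inj }
      where
      common : ∀ u v → Edge u v ⊎ Edge v u → ∃ λ i → InPiece i u × InPiece i v
      common u v (inj₁ e) = covering-piece u v e
      common u v (inj₂ e) with covering-piece v u e
      ... | i , p , q = i , q , p
      surj : ∀ x y → Adj grid x y → ∃ λ i → ∃₂ λ u v →
        Adj (piece i) u v × Piece.pick i u ≡ x × Piece.pick i v ≡ y
      surj x y e with common x y (Adj⇒Edge e)
      ... | i , px , py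
        with Piece.complete i x (dec-true (inPiece? i x) px) | Piece.complete i y (dec-true (inPiece? i y) py)
      ...   | u , refl | v , refl = i , u , v , e , refl , refl

    -- A vertex lies in piece `i` only if `i` is its height or the owner of its column; each
    -- alternative is met by at most one `i`.
    pieces-cover-local : ∀ {𝒢} (in𝒢 : ∀ i → 𝒢 (piece i)) v → preimages (pieces-cover {𝒢} in𝒢) v ≤ 2
    pieces-cover-local in𝒢 v = ≤-trans (sumFin-mono n bound)
      (≤-trans (≤-reflexive (sumFin-+ n _ _))
        (+-mono-≤ (sumFin-δ n (Y v)) (sumFin-δ n (toℕ (owner (col v))))))
      where
      bound : ∀ i → countPre (Piece.pick i) v ≤ δ (Y v) (toℕ i) + δ (toℕ (owner (col v))) (toℕ i)
      bound i with inPiece? i v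
      ... | no ¬p = ≤-trans (≤-reflexive (countPre-none (Piece.pick i) v
              λ { j refl → ¬p (does⇒ (inPiece? i _) (Piece.sound i j)) })) z≤n
      ... | yes (inj₁ y) = ≤-trans (countPre-inj (Piece.pick i) v (Piece.pick-inj i))
              (≤-trans (≤-reflexive (≡-sym (trans (cong (λ m → δ m (toℕ i)) y) (δ-refl (toℕ i))))) (m≤m+n _ _))
      ... | yes (inj₂ (_ , refl , _)) = ≤-trans (countPre-inj (Piece.pick i) v (Piece.pick-inj i))
              (≤-trans (≤-reflexive (≡-sym (δ-refl (toℕ i)))) (m≤n+m _ _))

    piece-hub : ∀ x → 0 < ℓ x → Σ (V (piece (owner x))) λ a →
      Piece.pick (owner x) a ≡ top x × DegreeAtLeast (piece (owner x)) a (ℓ x)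
    piece-hub x pos with Piece.complete i (top x) (dec-true (inPiece? i (top x)) top∈)
      where
      i = owner x
      ct = col-vertex x (cell< ≤-refl)
      top∈ : InPiece i (top x)
      top∈ = inj₂ (subst (λ x → 0 < ℓ x) (≡-sym ct) pos , cong owner ct ,
        subst (_≤ n + ℓ (col (top x))) (≡-sym (Y-vertex x (cell< ≤-refl))) (m≤m+n n _))
    ... | a , pa = a , pa , nbr , (λ j → subst₂ (Adj grid) (≡-sym pa) (≡-sym (pick-nbr j)) (leaf-adj x j)) ,
        λ {j} {k} eq → leaf-inj x (trans (≡-sym (pick-nbr j)) (trans (cong (Piece.pick i) eq) (pick-nbr k)))
      where
      i = owner x
      leaf∈ : ∀ j → InPiece i (leaf x j)
      leaf∈ j = inj₂ (subst (λ x → 0 < ℓ x) (≡-sym cl) pos , cong owner cl ,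
        subst₂ (λ y x → y ≤ n + ℓ x) (≡-sym (Y-vertex x (leaf< x j))) (≡-sym cl) (+-monoʳ-< n (toℕ<n j)))
        where cl = col-vertex x (leaf< x j)
      found : ∀ j → ∃ λ b → Piece.pick i b ≡ leaf x j
      found j = Piece.complete i (leaf x j) (dec-true (inPiece? i (leaf x j)) (leaf∈ j))
      nbr : Fin (ℓ x) → V (piece i)
      nbr j = proj₁ (found j)
      pick-nbr : ∀ j → Piece.pick i (nbr j) ≡ leaf x j
      pick-nbr j = proj₂ (found j)

    -- Rows lie below height `n`, so a vertex at height `n` belongs to the piece through its column.
    piece-column : ∀ i a → Y (Piece.pick i a) ≡ n →
      owner (col (Piece.pick i a)) ≡ i
    piece-column i a y with does⇒ (inPiece? i (Piece.pick i a)) (Piece.sound i a)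
    ... | inj₁ y′            = ⊥-elim (<⇒≢ (toℕ<n i) (trans (≡-sym y′) y))
    ... | inj₂ (_ , eq , _) = eq

-- The `N`-th grid: constants, arcs, hubs and tripods.

odd-+ : ∀ a b → odd (a + b) ≡ odd a xor odd b
odd-+ zero    b = refl
odd-+ (suc a) b = trans (cong not (odd-+ a b)) (not-distribˡ-xor (odd a) (odd b))

odd-2* : ∀ m → odd (2 * m) ≡ false
odd-2* m = trans (cong (λ k → odd (m + k)) (+-identityʳ m)) (trans (odd-+ m m) (xor-same (odd m)))

drawing-pull : ∀ {G H} → G ↪ H → Drawing H → Drawing G
drawing-pull f 𝒟 = record
  { before = λ a b → before (fun f a) (fun f b)
  ; above = λ a b v → above (fun f a) (fun f b) (fun f v)
  ; before-asym = λ a≢b → before-asym (a≢b ∘ fun-inj f)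
  ; noncrossing = λ ab cd ac ad bc bd → noncrossing (fun-hom f _ _ ab) (fun-hom f _ _ cd)
      (ac ∘ fun-inj f) (ad ∘ fun-inj f) (bc ∘ fun-inj f) (bd ∘ fun-inj f) }
  where open Drawing 𝒟

-- Degrees below small N are negligible in the N-th graph: N parts in which a
-- vertex has degree at most small N cannot cover medium N edges there.
small medium big : ℕ → ℕ
small zero    = 4
small (suc N) = 4 + (5 + suc (suc N * small N))
medium N = suc (suc N * small N)
big N = 5 + medium N

small-step : ∀ N → small N ≤ small (suc N)
small-step N = ≤-trans (m≤m+n (small N) (N * small N)) (m≤n+m (suc N * small N) 10)

-- Since `small (suc M)` is `4 + big M`, which bounds all degrees in the `M`-th grid, `small N`
-- bounds the degrees in all earlier grids.
small-mono : ∀ {M N} → M ≤ N → small M ≤ small N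
small-mono {N = zero}  z≤n = ≤-refl
small-mono {M} {suc N} le with m≤n⇒m<n∨m≡n le
... | inj₁ (s≤s lt) = ≤-trans (small-mono lt) (small-step N)
... | inj₂ refl     = ≤-refl

4≤small : ∀ N → 4 ≤ small N
4≤small N = small-mono {0} {N} z≤n

small<big : ∀ N → small N < big N
small<big N = ≤-trans (s≤s (m≤m+n (small N) (N * small N))) (m≤n+m (medium N) 5)

module Instance (N : ℕ) where

  -- A column number has the digits arc, owner and bit, the arc being the most significant; so the
  -- arcs are consecutive intervals, each with two columns per owner.
  n w : ℕ
  n = suc N
  w = 3 * (n * 2)

  isOne : Fin 2 → Bool
  isOne β = odd (toℕ β)

  abstract
    arc : Fin w → Fin 3
    arc x = proj₁ (remQuot {3} (n * 2) x)

    owner : Fin w → Fin n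
    owner x = proj₁ (remQuot {n} 2 (proj₂ (remQuot {3} (n * 2) x)))

    bit : Fin w → Fin 2
    bit x = proj₂ (remQuot {n} 2 (proj₂ (remQuot {3} (n * 2) x)))

    column : Fin 3 → Fin n → Fin 2 → Fin w
    column a i β = combine a (combine i β)

    arc-column : ∀ a i β → arc (column a i β) ≡ a
    arc-column a i β = cong proj₁ (remQuot-combine a (combine i β))

    owner-column : ∀ a i β → owner (column a i β) ≡ i
    owner-column a i β = trans (cong (proj₁ ∘ remQuot {n} 2 ∘ proj₂) (remQuot-combine a (combine i β)))
      (cong proj₁ (remQuot-combine i β))

    bit-column : ∀ a i β → bit (column a i β) ≡ β
    bit-column a i β = trans (cong (proj₂ ∘ remQuot {n} 2 ∘ proj₂) (remQuot-combine a (combine i β)))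
      (cong proj₂ (remQuot-combine i β))

    column-η : ∀ x → column (arc x) (owner x) (bit x) ≡ x
    column-η x = trans (cong (combine (arc x)) (combine-remQuot {n} 2 _)) (combine-remQuot {3} (n * 2) x)

    arc-mono : ∀ {x y} → toℕ (arc x) < toℕ (arc y) → toℕ x < toℕ y
    arc-mono {x} {y} lt = subst₂ (λ x y → toℕ x < toℕ y) (column-η x) (column-η y)
      (combine-monoˡ-< (combine (owner x) (bit x)) (combine (owner y) (bit y)) lt)
    -- The digits above the bit contribute even numbers.
    odd-bit : ∀ x → odd (toℕ x) ≡ isOne (bit x)
    odd-bit x = begin
      odd (toℕ x)
        ≡⟨ cong (odd ∘ toℕ) (column-η x) ⟨
      odd (toℕ (column (arc x) (owner x) (bit x)))
        ≡⟨ cong odd (toℕ-combine (arc x) (combine (owner x) (bit x))) ⟩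
      odd (n * 2 * toℕ (arc x) + toℕ (combine (owner x) (bit x)))
        ≡⟨ odd-+ (n * 2 * toℕ (arc x)) _ ⟩
      odd (n * 2 * toℕ (arc x)) xor odd (toℕ (combine (owner x) (bit x)))
        ≡⟨ cong₂ _xor_ (trans (cong odd (trans (cong (_* toℕ (arc x)) (*-comm n 2)) (*-assoc 2 n (toℕ (arc x))))) (odd-2* (n * toℕ (arc x))))
             (cong odd (toℕ-combine (owner x) (bit x))) ⟩
      odd (2 * toℕ (owner x) + toℕ (bit x))
        ≡⟨ odd-+ (2 * toℕ (owner x)) _ ⟩
      odd (2 * toℕ (owner x)) xor isOne (bit x)
        ≡⟨ cong (_xor isOne (bit x)) (odd-2* (toℕ (owner x))) ⟩
      isOne (bit x) ∎
      where open ≡-Reasoning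

  -- The bit fixes the colour of a hub: arc 2 uses bit 1 so that its hubs differ in colour from
  -- those of arc 0. As `big N` is `5 + medium N`, the large hubs exceed the degree bound
  -- `4 + medium N` of all other vertices.
  hubLeaves : Fin 3 → Fin 2 → ℕ
  hubLeaves 0F 0F = big N
  hubLeaves 1F 0F = medium N
  hubLeaves 2F 1F = big N
  hubLeaves _  _  = 0

  hubLeaves≤big : ∀ a β → hubLeaves a β ≤ big N
  hubLeaves≤big 0F 0F = ≤-refl
  hubLeaves≤big 0F 1F = z≤n
  hubLeaves≤big 1F 0F = m≤n+m (medium N) 5
  hubLeaves≤big 1F 1F = z≤n
  hubLeaves≤big 2F 0F = z≤n
  hubLeaves≤big 2F 1F = ≤-refl

  ℓ : Fin w → ℕ
  ℓ x = hubLeaves (arc x) (bit x)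

  ℓ-column : ∀ a i β → ℓ (column a i β) ≡ hubLeaves a β
  ℓ-column a i β = cong₂ hubLeaves (arc-column a i β) (bit-column a i β)

  ℓ≤big : ∀ x → ℓ x ≤ big N
  ℓ≤big x = hubLeaves≤big (arc x) (bit x)

  open HairyGrid n w (big N) ℓ ℓ≤big public
  open Pieces owner zero refl public

  centre : Fin n → Vertex
  centre i = top (column 1F i 0F)

  centre-col : ∀ i → col (centre i) ≡ column 1F i 0F
  centre-col i = col-vertex _ (cell< ≤-refl)

  centre-Y : ∀ i → Y (centre i) ≡ n
  centre-Y i = Y-vertex (column 1F i 0F) (cell< ≤-refl)

  centre-inj : ∀ {i j} → centre i ≡ centre j → i ≡ j
  centre-inj {i} {j} eq = trans (≡-sym (owner-column 1F i 0F)) (trans (cong owner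
    (trans (≡-sym (centre-col i)) (trans (cong col eq) (centre-col j)))) (owner-column 1F j 0F))

  color-hub : ∀ {v} → Y v ≡ n → color v ≡ isOne (bit (col v)) xor odd n
  color-hub {v} y = trans (color-top y) (trans (odd-+ (X v) n) (cong (_xor odd n) (odd-bit (col v))))

  centre-degree : ∀ i → DegreeAtMost grid (centre i) (4 + medium N)
  centre-degree i = subst (λ d → DegreeAtMost grid (centre i) (4 + d))
    (trans (cong ℓ (centre-col i)) (ℓ-column 1F i 0F)) (degree-column (centre i))

  Corner : Vertex → Fin 3 → Fin 2 → Set
  Corner v a β = Y v ≡ n × arc (col v) ≡ a × bit (col v) ≡ β

  big-degree : ∀ v → DegreeAtLeast grid v (big N) → Corner v 0F 0F ⊎ Corner v 2F 1F
  big-degree v deg = case Y v ≟ n of λ where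
      (no ¬top) → ⊥-elim (<⇒≱ (s≤s (m≤m+n 4 _)) (degree-bounds {grid} {v} deg (degree-non-top v ¬top)))
      (yes y)   → go y (arc (col v)) (bit (col v)) refl refl
    where
    bound : big N ≤ 4 + ℓ (col v)
    bound = degree-bounds {grid} {v} deg (degree-column v)
    none : ∀ a β → arc (col v) ≡ a → bit (col v) ≡ β → hubLeaves a β ≤ medium N → ⊥
    none a β refl refl le = <⇒≱ (n<1+n (4 + medium N)) (≤-trans bound (+-monoʳ-≤ 4 le))
    go : Y v ≡ n → ∀ a β → arc (col v) ≡ a → bit (col v) ≡ β → Corner v 0F 0F ⊎ Corner v 2F 1F
    go y 0F 0F p q = inj₁ (y , p , q)
    go y 2F 1F p q = inj₂ (y , p , q)
    go y 0F 1F p q = ⊥-elim (none _ _ p q z≤n)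
    go y 1F 0F p q = ⊥-elim (none _ _ p q ≤-refl)
    go y 1F 1F p q = ⊥-elim (none _ _ p q z≤n)
    go y 2F 0F p q = ⊥-elim (none _ _ p q z≤n)

  hub-in-copy : ∀ {G} i (iso : G ≅ piece i) x → owner x ≡ i → 0 < ℓ x →
    Σ (V G) λ b → Piece.pick i (_≅_.to iso b) ≡ top x × DegreeAtLeast G b (ℓ x)
  hub-in-copy {G} i iso x refl pos with piece-hub x pos
  ... | a , eq , deg = _≅_.from iso a , trans (cong (Piece.pick i) (_≅_.to-from iso a)) eq ,
        degreeAtLeast-push {piece i} {G} {a} (≅⇒↪ (≅-sym iso)) deg

  copy-↪ : ∀ {G} i → G ≅ piece i → G ↪ grid
  copy-↪ i iso = Piece.inclusion i ∘↪ ≅⇒↪ iso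

  record Tripod {G : Graph} (f : G ↪ grid) : Set where
    field
      a₀ a₁ a₂ : V G
      top₀ : Y (fun f a₀) ≡ n
      top₁ : Y (fun f a₁) ≡ n
      top₂ : Y (fun f a₂) ≡ n
      arc₀ : arc (col (fun f a₀)) ≡ 0F
      arc₁ : arc (col (fun f a₁)) ≡ 1F
      arc₂ : arc (col (fun f a₂)) ≡ 2F

  -- Compare the points in arc 0. If that of `f` is further left, the walk of `f` from arc 0 to arc
  -- 1 interlaces the walk of `f′` from arc 0 to arc 2. The reverse case is symmetric, and equal
  -- columns give a common vertex.
  tripods-meet : ∀ {G G′} {f : G ↪ grid} {f′ : G′ ↪ grid} → Connected G → Connected G′ →
    Tripod f → Tripod f′ → ¬ (∀ b b′ → fun f b ≢ fun f′ b′)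
  tripods-meet {G} {G′} {f} {f′} conn conn′ T T′ disj = case <-cmp (X (fun f T.a₀)) (X (fun f′ T′.a₀)) of λ where
      (tri< lt _ _) → interlaced-walks-meet (walk f conn T.a₀ T.a₁) (walk f′ conn′ T′.a₀ T′.a₂)
        T.top₀ T.top₁ T′.top₀ T′.top₂ lt (arcs T′.arc₀ T.arc₁ (s≤s z≤n)) (arcs T.arc₁ T′.arc₂ ≤-refl)
        λ { _ (b , refl) (b′ , eq) → disj b b′ (≡-sym eq) }
      (tri≈ _ eq _) → disj _ _ (vertex-unique′ eq (trans T.top₀ (≡-sym T′.top₀)))
      (tri> _ _ gt) → interlaced-walks-meet (walk f′ conn′ T′.a₀ T′.a₁) (walk f conn T.a₀ T.a₂)
        T′.top₀ T′.top₁ T.top₀ T.top₂ gt (arcs T.arc₀ T′.arc₁ (s≤s z≤n)) (arcs T′.arc₁ T.arc₂ ≤-refl)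
        λ { _ (b′ , refl) (b , eq) → disj b b′ eq }
    where
    module T = Tripod T
    module T′ = Tripod T′
    walk : ∀ {G} (f : G ↪ grid) → Connected G → ∀ a b → Conn grid (λ v → ∃ λ b → fun f b ≡ v) (fun f a) (fun f b)
    walk f conn a b = Conn-image (fun f) (fun-hom f) (λ w _ → w , refl) (conn a b)
    arcs : ∀ {u v a b} → arc (col u) ≡ a → arc (col v) ≡ b → toℕ a < toℕ b → X u < X v
    arcs refl refl lt = arc-mono lt

  -- The colour classes tell arc 2 from arc 0, although both carry hubs of the same degree.
  copy-tripod : ∀ {G} i (iso : G ≅ piece i) → Connected G → (f : G ↪ grid) → ∀ a j →
    Piece.pick i (_≅_.to iso a) ≡ centre i → fun f a ≡ centre j → Tripod f
  copy-tripod {G} i iso conn f a j θa fa = record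
    { a₀ = proj₁ corner₀ ; a₁ = a ; a₂ = proj₁ corner₂
    ; top₀ = proj₁ (proj₂ corner₀) ; top₁ = trans (cong Y fa) (centre-Y j) ; top₂ = proj₁ (proj₂ corner₂)
    ; arc₀ = proj₂ (proj₂ corner₀)
    ; arc₁ = trans (cong (arc ∘ col) fa) (trans (cong arc (centre-col j)) (arc-column 1F j 0F))
    ; arc₂ = proj₂ (proj₂ corner₂) }
    where
    θ : G ↪ grid
    θ = copy-↪ i iso

    centre-color : ∀ k → color (centre k) ≡ odd n
    centre-color k = trans (color-hub (centre-Y k))
      (cong (λ β → isOne β xor odd n) (trans (cong bit (centre-col k)) (bit-column 1F k 0F)))

    -- All centres have one colour, so the colourings pulled back along `f` and `θ` agree at `a`;
    -- connectedness carries the agreement to `b`.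
    same-color : ∀ b → color (fun f b) ≡ color (fun θ b)
    same-color b = xor-≡ (color (fun f b)) (color (fun θ b)) (trans
      (bipartitions-agree {G} (bipartition-pull {G} f color-bipartition) (bipartition-pull {G} θ color-bipartition) (conn b a))
      (trans (cong₂ _xor_ (trans (cong color fa) (centre-color j)) (trans (cong color θa) (centre-color i)))
        (xor-same (odd n))))
      where
      xor-≡ : ∀ x y → x xor y ≡ false → x ≡ y
      xor-≡ false false _ = refl
      xor-≡ true  true  _ = refl

    same-bit : ∀ b x → fun θ b ≡ top x → Y (fun f b) ≡ n → isOne (bit (col (fun f b))) ≡ isOne (bit x)
    same-bit b x eq y = xor-cancel (odd n) (trans (≡-sym (color-hub y)) (trans (same-color b)
      (trans (cong color eq) (trans (color-hub (Y-vertex x (cell< ≤-refl)))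
        (cong (λ x → isOne (bit x) xor odd n) (col-vertex x (cell< ≤-refl)))))))
      where
      xor-cancel : ∀ o {x y} → x xor o ≡ y xor o → x ≡ y
      xor-cancel o {false} {false} _  = refl
      xor-cancel o {true}  {true}  _  = refl
      xor-cancel false {false} {true} ()
      xor-cancel true  {false} {true} ()
      xor-cancel false {true} {false} ()
      xor-cancel true  {true} {false} ()

    hub : ∀ c β → hubLeaves c β ≡ big N → Σ (V G) λ b →
      (Corner (fun f b) 0F 0F ⊎ Corner (fun f b) 2F 1F) × fun θ b ≡ top (column c i β)
    hub c β full with hub-in-copy i iso (column c i β) (owner-column c i β)
        (subst (0 <_) (≡-sym (trans (ℓ-column c i β) full)) (s≤s z≤n))
    ... | b , eq , deg = b , big-degree _ (degreeAtLeast-push {G} {grid} {b} f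
            (subst (DegreeAtLeast G b) (trans (ℓ-column c i β) full) deg)) , eq

    corner₀ : ∃ λ b → Y (fun f b) ≡ n × arc (col (fun f b)) ≡ 0F
    corner₀ with hub 0F 0F refl
    ... | b , inj₁ (y , p , _) , _ = b , y , p
    -- A corner in arc 2 has bit 1, but the hub of the piece has bit 0, against equal colours.
    ... | b , inj₂ (y , _ , q) , eq with () ← trans (≡-sym (cong isOne q))
            (trans (same-bit b _ eq y) (cong isOne (bit-column 0F i 0F)))

    corner₂ : ∃ λ b → Y (fun f b) ≡ n × arc (col (fun f b)) ≡ 2F
    corner₂ with hub 2F 1F refl
    ... | b , inj₂ (y , p , _) , _ = b , y , p
    ... | b , inj₁ (y , _ , q) , eq with () ← trans (≡-sym (cong isOne q))
            (trans (same-bit b _ eq y) (cong isOne (bit-column 2F i 1F)))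

-- The two graph classes, and auxiliary facts on sums and finite choice.

K2OrPiece : GraphClass
K2OrPiece G = G ≅ K2 ⊎ ∃₂ λ N i → G ≅ Instance.piece N i

-- Connectedness makes a component of a member isomorphic to the member, so component-closedness
-- reduces to invariance under isomorphism.
pieceClass : GraphClass
pieceClass G = Connected G × K2OrPiece G

gridClass : GraphClass
gridClass H = ∃ λ N → H ≅ Instance.grid N

-- All neighbours of a vertex lie in its own summand, so the code there can be transported.
degreeAtMost-summand : ∀ Gs m a {D} → DegreeAtMost (lookup Gs m) a D →
  DegreeAtMost (⨁ Gs) (summand Gs m a) D
degreeAtMost-summand Gs m a {D} (code , bound , code-inj) = degreeAtMost-by {⨁ Gs} {summand Gs m a} R
  (λ v e → total v e (summand-closed Gs m a v e))
  λ { u v k (b , refl , eb , refl) (b′ , refl , eb′ , eq) → cong (summand Gs m) (code-inj b b′ eb eb′ (≡-sym eq)) }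
  where
  R : V (⨁ Gs) → ℕ → Set
  R v k = ∃ λ b → summand Gs m b ≡ v × Adj (lookup Gs m) a b × code b ≡ k
  total : ∀ v → Adj (⨁ Gs) (summand Gs m a) v → (∃ λ b → summand Gs m b ≡ v) → ∃ λ k → k < D × R v k
  total v e (b , refl) = code b , bound b ab , b , refl , ab , refl
    where ab = trans (≡-sym (summand-adj Gs m a b)) e

∃-or-∀ : ∀ {n} {A B : Fin n → Set} → (∀ i → A i ⊎ B i) → (∃ A) ⊎ (∀ i → B i)
∃-or-∀ {zero}  f = inj₂ λ ()
∃-or-∀ {suc n} f with f zero | ∃-or-∀ (f ∘ suc)
... | inj₁ a | _            = inj₁ (zero , a)
... | inj₂ _ | inj₁ (i , a) = inj₁ (suc i , a)
... | inj₂ b | inj₂ bs      = inj₂ λ { zero → b ; (suc i) → bs i }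

-- The lower bound for the global number.

module LowerBound (N : ℕ) where
  open Instance N

  -- The equation pins the index and the isomorphism to those stored in `g`, so two central vertices
  -- of one member correspond to the same centre.
  Central : ∀ {G} → K2OrPiece G → V G → Set
  Central {G} g a = ∃₂ λ i iso → g ≡ inj₂ (N , i , iso) × Piece.pick i (_≅_.to iso a) ≡ centre i

  -- All degrees in the `N′`-th grid are at most `4 + big N′`, which is `small (suc N′)`.
  smaller-copy : ∀ {G} N′ i (iso : G ≅ Instance.piece N′ i) → N′ < N → ∀ a → DegreeAtMost G a (small N)
  smaller-copy {G} N′ i iso N′<N a = degreeAtMost-mono {G} {a} {4 + N′.ℓ (N′.col (fun θ a))} {small N}
      (≤-trans (+-monoʳ-≤ 4 (N′.ℓ≤big (N′.col (fun θ a)))) (small-mono N′<N))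
      (degreeAtMost-pull {G} {N′.grid} {a} θ (N′.degree-column (fun θ a)))
    where
    module N′ = Instance N′
    θ : G ↪ N′.grid
    θ = N′.copy-↪ i iso

  -- A hub in arc 0 has at least `big N′` neighbours, more than `small N′` and hence more than
  -- `small (suc N)`, which bounds the degrees in `grid`.
  no-larger-copy : ∀ {G} N′ i (iso : G ≅ Instance.piece N′ i) → N < N′ → ¬ (G ↪ grid)
  no-larger-copy {G} N′ i iso N<N′ f = <⇒≱ (small<big N′) (≤-trans too-big (small-mono N<N′))
    where
    module N′ = Instance N′
    x = N′.column 0F i 0F
    ℓx : N′.ℓ x ≡ big N′
    ℓx = N′.ℓ-column 0F i 0F
    hub = N′.hub-in-copy i iso x (N′.owner-column 0F i 0F) (subst (0 <_) (≡-sym ℓx) (s≤s z≤n))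
    b = proj₁ hub
    too-big : big N′ ≤ 4 + big N
    too-big = ≤-trans (degree-bounds {grid} {fun f b}
        (degreeAtLeast-push {G} {grid} {b} f (subst (DegreeAtLeast G b) ℓx (proj₂ (proj₂ hub))))
        (degree-column (fun f b)))
      (+-monoʳ-≤ 4 (ℓ≤big (col (fun f b))))

  -- Away from the hubs degrees are at most 4, and a large hub has too many neighbours to be sent to
  -- `centre j`. What remains is the one middle hub of the piece.
  same-size-copy : ∀ {G} i (iso : G ≅ piece i) (f : G ↪ grid) a j → fun f a ≡ centre j →
    DegreeAtMost G a (small N) ⊎ Piece.pick i (_≅_.to iso a) ≡ centre i
  same-size-copy {G} i iso f a j fa = case Y v ≟ n of λ where
      (no ¬top) → inj₁ (pull (4≤small N) (degree-non-top v ¬top))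
      (yes y)   → at-top y (arc (col v)) (bit (col v)) refl refl
    where
    v = Piece.pick i (_≅_.to iso a)
    pull : ∀ {D} → D ≤ small N → DegreeAtMost grid v D → DegreeAtMost G a (small N)
    pull le deg = degreeAtMost-mono {G} {a} le (degreeAtMost-pull {G} {grid} {a} (copy-↪ i iso) deg)
    no-leaves : ∀ c β → arc (col v) ≡ c → bit (col v) ≡ β → hubLeaves c β ≡ 0 → DegreeAtMost G a (small N)
    no-leaves c β refl refl eq = pull (≤-trans (≤-reflexive (cong (4 +_) eq)) (4≤small N)) (degree-column v)
    v≡top : ∀ x → Y v ≡ n → col v ≡ x → v ≡ top x
    v≡top x y eq = vertex-unique (trans eq (≡-sym (col-vertex x (cell< ≤-refl))))
      (trans y (≡-sym (Y-vertex x (cell< ≤-refl))))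
    full : ∀ c β → Y v ≡ n → arc (col v) ≡ c → bit (col v) ≡ β → hubLeaves c β ≡ big N → ⊥
    full c β y refl refl eq = <⇒≱ (n<1+n (4 + medium N)) (degree-bounds {grid} {centre j}
        (subst₂ (DegreeAtLeast grid) (trans (cong (fun f) b≡a) fa) eq
          (degreeAtLeast-push {G} {grid} {b} f (proj₂ (proj₂ hub))))
        (centre-degree j))
      where
      hub = hub-in-copy i iso (col v) (piece-column i (_≅_.to iso a) y) (subst (0 <_) (≡-sym eq) (s≤s z≤n))
      b = proj₁ hub
      b≡a : b ≡ a
      b≡a = fun-inj (copy-↪ i iso) (trans (proj₁ (proj₂ hub)) (≡-sym (v≡top (col v) y refl)))
    at-top : Y v ≡ n → ∀ c β → arc (col v) ≡ c → bit (col v) ≡ β →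
      DegreeAtMost G a (small N) ⊎ v ≡ centre i
    at-top y 0F 0F p q = ⊥-elim (full _ _ y p q refl)
    at-top y 2F 1F p q = ⊥-elim (full _ _ y p q refl)
    at-top y 1F 0F p q = inj₂ (v≡top _ y (trans (≡-sym (column-η (col v)))
      (cong₃ column p (piece-column i (_≅_.to iso a) y) q)))
      where
      cong₃ : ∀ {A B C D : Set} (h : A → B → C → D) {a a′ b b′ c c′} →
        a ≡ a′ → b ≡ b′ → c ≡ c′ → h a b c ≡ h a′ b′ c′
      cong₃ h refl refl refl = refl
    at-top y 0F 1F p q = inj₁ (no-leaves _ _ p q refl)
    at-top y 1F 1F p q = inj₁ (no-leaves _ _ p q refl)
    at-top y 2F 0F p q = inj₁ (no-leaves _ _ p q refl)

  classify : ∀ {G} (g : K2OrPiece G) (f : G ↪ grid) a j → fun f a ≡ centre j →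
    DegreeAtMost G a (small N) ⊎ Central g a
  classify {G} (inj₁ iso) f a j fa = inj₁ (degreeAtMost-mono {G} {a} (≤-trans (m≤m+n 2 2) (4≤small N))
    -- The vertex numbers of `K2` serve as codes below 2.
    (toℕ ∘ _≅_.to iso , (λ b _ → toℕ<n (_≅_.to iso b)) ,
     λ b b′ _ _ eq → fun-inj (≅⇒↪ iso) (toℕ-injective eq)))
  classify {G} (inj₂ (N′ , i , iso)) f a j fa = compare (<-cmp N′ N) i iso
    where
    compare : ∀ {N′} → Tri (N′ < N) (N′ ≡ N) (N < N′) → ∀ i (iso : G ≅ Instance.piece N′ i) →
      DegreeAtMost G a (small N) ⊎ Central (inj₂ (N′ , i , iso)) a
    compare (tri< lt _ _)   i iso = inj₁ (smaller-copy _ i iso lt a)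
    compare (tri> _ _ gt)   i iso = ⊥-elim (no-larger-copy _ i iso gt f)
    compare (tri≈ _ refl _) i iso = case same-size-copy i iso f a j fa of λ where
      (inj₁ deg) → inj₁ deg
      (inj₂ eq)  → inj₂ (i , iso , refl , eq)

  central-unique : ∀ {G} (g : K2OrPiece G) {a a′} → Central g a → Central g a′ → a ≡ a′
  central-unique g (i , iso , refl , θa) (.i , .iso , refl , θa′) =
    fun-inj (copy-↪ i iso) (trans θa (≡-sym θa′))

  module _ {Gs : List Graph} (all : All pieceClass Gs) (F : ⨁ Gs ↪ grid) where

    membership : ∀ m → pieceClass (lookup Gs m)
    membership m = All.lookup all (∈-lookup m)

    component : ∀ m → lookup Gs m ↪ grid
    component m = F ∘↪ summand-↪ Gs m

    Centred : Fin n → Set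
    Centred j = ∃₂ λ m a → fun (component m) a ≡ centre j × Central (proj₂ (membership m)) a

    -- Quantifying over the preimages of `centre j` also covers parts that miss this vertex; the
    -- code is then arbitrary.
    SparseAt : Fin n → Set
    SparseAt j = Σ (V (⨁ Gs) → ℕ) λ code → ∀ v → fun F v ≡ centre j →
      (∀ b → Adj (⨁ Gs) v b → code b < small N) ×
      (∀ b b′ → Adj (⨁ Gs) v b → Adj (⨁ Gs) v b′ → code b ≡ code b′ → b ≡ b′)

    centred-or-sparse : ∀ j → Centred j ⊎ SparseAt j
    centred-or-sparse j = case any? (λ v → fun F v Fin.≟ centre j) of λ where
        (no none)       → inj₂ ((λ _ → 0) , λ v eq → ⊥-elim (none (v , eq)))
        (yes (v , Fv)) → at v Fv (summand-vertex Gs v)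
      where
      at : ∀ v → fun F v ≡ centre j → (∃₂ λ m a → summand Gs m a ≡ v) → Centred j ⊎ SparseAt j
      at _ Fv (m , a , refl) = case classify (proj₂ (membership m)) (component m) a j Fv of λ where
        (inj₂ central) → inj₁ (m , a , Fv , central)
        (inj₁ deg)     → inj₂ (proj₁ (degreeAtMost-summand Gs m a deg) , λ v′ Fv′ →
          subst (λ u → (∀ b → Adj (⨁ Gs) u b → _ < small N) ×
                       (∀ b b′ → Adj (⨁ Gs) u b → Adj (⨁ Gs) u b′ → _ ≡ _ → b ≡ b′))
            (fun-inj F (trans Fv (≡-sym Fv′))) (proj₂ (degreeAtMost-summand Gs m a deg)))

    -- In one summand both central vertices coincide. Two different summands would give tripods with
    -- disjoint images, against `tripods-meet`.
    centred-unique : ∀ {j j′} → Centred j → Centred j′ → j ≡ j′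
    centred-unique {j} {j′} (m , a , Fa , central) (m′ , a′ , Fa′ , central′) =
      compare (m Fin.≟ m′) a′ Fa′ central′
      where
      tripod : ∀ m a k → fun (component m) a ≡ centre k → Central (proj₂ (membership m)) a → Tripod (component m)
      tripod m a k Fa (i , iso , _ , θa) = copy-tripod i iso (proj₁ (membership m)) (component m) a k θa Fa
      compare : ∀ {m′} → Dec (m ≡ m′) → ∀ a′ → fun (component m′) a′ ≡ centre j′ →
        Central (proj₂ (membership m′)) a′ → j ≡ j′
      compare (yes refl) a′ Fa′ central′ = centre-inj (trans (≡-sym Fa) (trans
        (cong (fun (component m)) (central-unique (proj₂ (membership m)) central central′)) Fa′))
      compare {m′} (no m≢m′) a′ Fa′ central′ = ⊥-elim (tripods-meet {f = component m} {f′ = component m′}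
        (proj₁ (membership m)) (proj₁ (membership m′)) (tripod m a j Fa central) (tripod m′ a′ j′ Fa′ central′)
        λ b b′ eq → m≢m′ (summand-disjoint Gs m m′ b b′ (fun-inj F eq)))

  global-cover-large : ∀ {u} → GlobalCover pieceClass grid u → N < u
  global-cover-large (c , refl) = ≰⇒> impossible
    where
    Gs : Fin (t c) → List Graph
    Gs p = proj₁ (inClass c p)
    all : ∀ p → All pieceClass (Gs p)
    all p = proj₁ (proj₂ (inClass c p))
    iso : ∀ p → ⨁ (Gs p) ≅ parts c p
    iso p = proj₂ (proj₂ (inClass c p))
    F : ∀ p → ⨁ (Gs p) ↪ grid
    F p = record { fun = maps c p ; fun-hom = hom c p ; fun-inj = inj c p } ∘↪ ≅⇒↪ (iso p)

    covered : ∀ x y → Adj grid x y → ∃ λ p → ∃₂ λ u v →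
      Adj (⨁ (Gs p)) u v × fun (F p) u ≡ x × fun (F p) v ≡ y
    covered x y e =
      let p , u , v , uv , eu , ev = edgeSurj c x y e
          open _≅_ (iso p)
      in  p , from u , from v , fun-hom (≅⇒↪ (≅-sym (iso p))) u v uv ,
          trans (cong (maps c p) (to-from u)) eu , trans (cong (maps c p) (to-from v)) ev

    -- Code the edge from `centre j` to a leaf by a part covering it and the code of the leaf in
    -- that part. This would fit `medium N`, that is `suc (suc N * small N)`, leaves injectively
    -- into at most `suc N * small N` slots.
    not-all-sparse : t c ≤ N → ∀ j → ¬ (∀ p → SparseAt (all p) (F p) j)
    not-all-sparse u≤N j sparse = <⇒≱ (n<1+n _) (≤-trans (≤-reflexive (≡-sym (ℓ-column 1F j 0F)))
        (≤-trans (injective⇒≤ {f = slot} slot-inj) (*-monoˡ-≤ (small N) (m≤n⇒m≤1+n u≤N))))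
      where
      x = column 1F j 0F
      cov : ∀ k → ∃ λ p → ∃₂ λ u v → Adj (⨁ (Gs p)) u v × fun (F p) u ≡ centre j × fun (F p) v ≡ leaf x k
      cov k = covered (centre j) (leaf x k) (leaf-adj x k)
      Cov : Fin (ℓ x) → Set
      Cov k = ∃ λ p → ∃₂ λ u v → Adj (⨁ (Gs p)) u v × fun (F p) u ≡ centre j × fun (F p) v ≡ leaf x k
      part : ∀ {k} → Cov k → Fin (t c)
      part (p , _) = p
      index : ∀ {k} → Cov k → Fin (small N)
      index (p , u , v , uv , Fu , _) = fromℕ< (proj₁ (proj₂ (sparse p) u Fu) v uv)
      slot : Fin (ℓ x) → Fin (t c * small N)
      slot k = combine (part (cov k)) (index (cov k))
      same-nbr : ∀ {p u u′ v v′} (Fu : fun (F p) u ≡ centre j) (Fu′ : fun (F p) u′ ≡ centre j)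
        (uv : Adj (⨁ (Gs p)) u v) (uv′ : Adj (⨁ (Gs p)) u′ v′) → u ≡ u′ →
        proj₁ (sparse p) v ≡ proj₁ (sparse p) v′ → v ≡ v′
      same-nbr {p} Fu Fu′ uv uv′ refl eq = proj₂ (proj₂ (sparse p) _ Fu) _ _ uv uv′ eq
      same-leaf : ∀ {k k′} (q : Cov k) (q′ : Cov k′) → part q ≡ part q′ → index q ≡ index q′ → k ≡ k′
      same-leaf (p , u , v , uv , Fu , Fv) (.p , u′ , v′ , uv′ , Fu′ , Fv′) refl eq =
        leaf-inj x (trans (≡-sym Fv) (trans (cong (fun (F p))
          (same-nbr Fu Fu′ uv uv′ (fun-inj (F p) (trans Fu (≡-sym Fu′))) (fromℕ<-injective _ _ _ _ eq))) Fv′))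
      slot-inj : Injective _≡_ _≡_ slot
      slot-inj {k} {k′} eq =
        let p≡ , i≡ = combine-injective (part (cov k)) (index (cov k)) (part (cov k′)) (index (cov k′)) eq
        in  same-leaf (cov k) (cov k′) p≡ i≡

    centred : t c ≤ N → ∀ j → ∃ λ p → Centred (all p) (F p) j
    centred u≤N j = case ∃-or-∀ (λ p → centred-or-sparse (all p) (F p) j) of λ where
      (inj₁ found)  → found
      (inj₂ sparse) → ⊥-elim (not-all-sparse u≤N j sparse)

    same-part : ∀ {j j′} (q : ∃ λ p → Centred (all p) (F p) j) (q′ : ∃ λ p → Centred (all p) (F p) j′) →
      proj₁ q ≡ proj₁ q′ → j ≡ j′
    same-part (p , q) (.p , q′) refl = centred-unique (all p) (F p) q q′

    impossible : ¬ (t c ≤ N)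
    impossible u≤N =
      let j , j′ , j<j′ , eq = pigeonhole (s≤s u≤N) (proj₁ ∘ centred u≤N)
      in  <⇒≢ j<j′ (cong toℕ (same-part (centred u≤N j) (centred u≤N j′) eq))

-- Unboundedness and the conclusion.

-- For undecided `P` a least witness is obtained only up to double negation, by well-founded
-- induction; this is enough when the goal is `⊥`.
least-exists : ∀ {P : ℕ → Set} {m} → P m → ¬ ¬ (∃ λ u → P u × (∀ k → P k → u ≤ k))
least-exists {P} pm none = <-rec (λ m → ¬ P m)
  (λ m ih pm → none (m , pm , λ k pk → ≮⇒≥ λ k<m → ih k<m pk)) _ pm

overline-cover : ∀ {𝒢 H} → InjCover 𝒢 H → InjCover (Overline 𝒢) H
overline-cover c = record
  { t = t c ; parts = parts c
  ; inClass = λ i → parts c i ∷ [] , inClass c i ∷ [] , singleton-≅ (parts c i)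
  ; maps = maps c ; hom = hom c ; edgeSurj = edgeSurj c ; inj = inj c }

K2-connected : Connected K2
K2-connected 0F 0F = here tt
K2-connected 0F 1F = step tt refl (here tt)
K2-connected 1F 0F = step tt refl (here tt)
K2-connected 1F 1F = here tt

pieceClass-iso : IsoClosed pieceClass
pieceClass-iso G H iso (conn , inj₁ k)           = ≅-connected iso conn , inj₁ (≅-trans (≅-sym iso) k)
pieceClass-iso G H iso (conn , inj₂ (N , i , k)) = ≅-connected iso conn , inj₂ (N , i , ≅-trans (≅-sym iso) k)

unbounded : ¬ Bounded gridClass pieceClass
unbounded (f , bound) =
  -- The cover by pieces, each read as a union of one graph, shows that some global cover exists.
  least-exists {λ u → GlobalCover pieceClass grid u} (overline-cover cover , refl) λ (u , isCu) →
  least-exists {λ l → LocalCover pieceClass grid l} (cover , pieces-cover-local {pieceClass} piece∈) λ (l , isCl) →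
  <⇒≱ (LowerBound.global-cover-large N (proj₁ isCu))
    (≤-trans (proj₂ (bound grid (N , ≅-refl) u l isCu isCl))
      (f≤N l (proj₂ isCl 2 (cover , pieces-cover-local {pieceClass} piece∈))))
  where
  -- Only the upper bound 2 for the local number is established, so `N` is chosen to dominate `f` at
  -- 0, 1 and 2.
  N = f 0 + (f 1 + f 2)
  open Instance N
  piece∈ : ∀ i → pieceClass (piece i)
  piece∈ i = piece-connected i , inj₂ (N , i , ≅-refl)
  cover : InjCover pieceClass grid
  cover = pieces-cover piece∈
  f≤N : ∀ l → l ≤ 2 → f l ≤ N
  f≤N 0 _ = m≤m+n (f 0) _
  f≤N 1 _ = ≤-trans (m≤m+n (f 1) (f 2)) (m≤n+m _ (f 0))
  f≤N 2 _ = ≤-trans (m≤n+m (f 2) (f 1)) (m≤n+m _ (f 0))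
  f≤N (suc (suc (suc _))) (s≤s (s≤s ()))

theorem7 : ∃ λ (M : Graph) → ∃ λ (ℋ : GraphClass) → ∃ λ (𝒢 : GraphClass) →
    IsoClosed ℋ × (∀ H → ℋ H → MinorFree M H) ×
    IsoClosed 𝒢 × ComponentClosed 𝒢 × 𝒢 K2 × ¬ Bounded ℋ 𝒢
theorem7 = K5 , gridClass , pieceClass ,
  (λ G H iso (N , k) → N , ≅-trans (≅-sym iso) k) ,
  (λ H (N , k) → drawing⇒no-K5-minor (drawing-pull (≅⇒↪ k) (Instance.drawing N))) ,
  pieceClass-iso ,
  (λ G C G∈ comp → pieceClass-iso G C (≅-sym (component-of-connected (proj₁ G∈) comp)) G∈) ,
  (K2-connected , inj₁ ≅-refl) ,
  unbounded
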